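{- Let $(M,\mathcal X)$ be a partitioned matroid with $\mathcal X=\{X_1,\ldots,X_n\}$, and let $(\widehat M,\mathcal Y)$ be its clonal core, $\mathcal Y=\{Y_1,\ldots,Y_n\}$. Then $|E(\widehat M)|=\lambda_M(X_1)+\cdots+\lambda_M(X_n)$. Moreover, in $(\widehat M,\mathcal Y)$: (i) each $Y_i$ is an independent, coindependent set of clones of cardinality $\lambda_M(X_i)$; and (ii) for all non-empty disjoint subsets $J,K$ of $[n]$, (a) $\lambda_M(X_J)=\lambda_{\widehat M}(Y_J)$; (b) $\sqcap_M(X_J,X_K)=\sqcap_{\widehat M}(Y_J,Y_K)$; (c) $\sqcap^*_M(X_J,X_K)=\sqcap^*_{\widehat M}(Y_J,Y_K)$.
   Context: For a matroid $N$ on ground set $E$ with rank function $r$: $\lambda_N(A)=r(A)+r(E-A)-r(N)$; for disjoint $X,Y$, $\sqcap_N(X,Y)=r(X)+r(Y)-r(X\cup Y)$ and $\sqcap^*_N=\sqcap_{N^*}$. A set $A\subseteq E$ is a set of clones if every permutation of $E$ fixing each element of $E-A$ is an automorphism of $N$. For a family $W_1,\ldots,W_n$ and $J\subseteq[n]$, $W_J=\bigcup_{j\in J}W_j$. A partitioned matroid is a pair $(M,\mathcal X)$ with $\mathcal X$ a partition of $E(M)$. Freely adding $e\notin E(N)$ into the guts of $Z\subseteq E(N)$: the single-element extension $N'$ of $N$ by $e$ such that, for each $X\subseteq E(N)$, $r_{N'}(X\cup\{e\})=r_N(X)$ if $\lambda_{N/X}(Z-X)=0$, and $r_{N'}(X\cup\{e\})=r_N(X)+1$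 otherwise (this is the extension given by the modular cut $\{X:\lambda_{N/X}(Z-X)=0\}$). Freely adding a set $\{e_1,\ldots,e_s\}$ into the guts of $Z$ means freely adding $e_1,\ldots,e_s$ one at a time, each into the guts of $Z$ in the current matroid. Clonal core of $(M,\{X_1,\ldots,X_n\})$, $E=E(M)$: choose pairwise disjoint sets $Y_1,\ldots,Y_n$, disjoint from $E$, with $|Y_i|=\lambda_M(X_i)$; let $M_0=M$ and, for $i\in[n]$, let $M_i$ be obtained from $M_{i-1}$ by freely adding the elements of $Y_i$ into the guts of $X_i$; set $\widehat M=M_n\backslash E$ and $\mathcal Y=\{Y_1,\ldots,Y_n\}$. -}

module Defs where

open import Data.Nat using (ℕ; zero; suc; _+_; _∸_; _≤_)
open import Data.Bool using (Bool; true; false; if_then_else_)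
open import Data.Fin using (Fin; fromℕ; inject₁)
import Data.Fin as Fin
open import Data.Fin.Subset using (Subset; inside; outside; _∈_; _∉_; _⊆_; _∪_; _∩_; ∁; ⊥; ⊤; ∣_∣; ⁅_⁆)
open import Data.Fin.Permutation using (Permutation′; _⟨$⟩ʳ_; _⟨$⟩ˡ_)
open import Data.Vec using (Vec; []; _∷_; _++_; replicate; tabulate; lookup; splitAt; init; last)
open import Data.Product using (Σ; _,_; _×_; ∃)
open import Relation.Binary.PropositionalEquality using (_≡_; _≢_)

Rk : ℕ → Set
Rk p = Subset p → ℕ

record IsMatroid {p : ℕ} (r : Rk p) : Set where
  field
    bounded    : ∀ X → r X ≤ ∣ X ∣
    monotone   : ∀ X Y → X ⊆ Y → r X ≤ r Y
    submodular : ∀ X Y → r (X ∪ Y) + r (X ∩ Y) ≤ r X + r Y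

conn : ∀ {p} → Rk p → Subset p → ℕ
conn r A = r A + r (∁ A) ∸ r ⊤

lc : ∀ {p} → Rk p → Subset p → Subset p → ℕ
lc r X Y = r X + r Y ∸ r (X ∪ Y)

dual : ∀ {p} → Rk p → Rk p
dual r X = ∣ X ∣ + r (∁ X) ∸ r ⊤

lcStar : ∀ {p} → Rk p → Subset p → Subset p → ℕ
lcStar r = lc (dual r)

independent : ∀ {p} → Rk p → Subset p → Set
independent r Y = r Y ≡ ∣ Y ∣

coindependent : ∀ {p} → Rk p → Subset p → Set
coindependent r Y = independent (dual r) Y

image : ∀ {p} → Permutation′ p → Subset p → Subset p
image σ X = tabulate (λ e → lookup X (σ ⟨$⟩ˡ e))

Clones : ∀ {p} → Rk p → Subset p → Set
Clones {p} r A = (σ : Permutation′ p) → (∀ e → e ∉ A → σ ⟨$⟩ʳ e ≡ e) →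
                 ∀ X → r (image σ X) ≡ r X

-- Contraction N/X (on ground set E - X), rank r_{N/X}(Y) = r(Y ∪ X) - r(X),
-- and λ_{N/X}(A) for A ⊆ E - X (complement taken in E - X).

rkContract : ∀ {p} → Rk p → Subset p → Subset p → ℕ
rkContract r X Y = r (Y ∪ X) ∸ r X

connContract : ∀ {p} → Rk p → Subset p → Subset p → ℕ
connContract r X A =
  rkContract r X A + rkContract r X (∁ A ∩ ∁ X) ∸ rkContract r X (∁ X)

-- Freely adding a new element e into the guts of Z.
-- The new element is placed at the front: ground set Fin (suc p), e = index 0.

gutsStep : ℕ → ℕ → ℕ
gutsStep zero    k = k
gutsStep (suc _) k = suc k

freeAdd1 : ∀ {p} → Rk p → Subset p → Rk (suc p)
freeAdd1 r Z (false ∷ X) = r X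
freeAdd1 r Z (true  ∷ X) = gutsStep (connContract r X (Z ∩ ∁ X)) (r X)

freeAddMany : ∀ {p} (s : ℕ) → Rk p → Subset p → Rk (s + p)
freeAddMany zero    r Z = r
freeAddMany (suc s) r Z = freeAdd1 (freeAddMany s r Z) (replicate s outside ++ Z)

-- Clonal core of (M, {X_1..X_n}) with M on Fin m.
-- s i = number of elements of Y_i.  The ground set of M_k is laid out as
-- Y_k ++ Y_{k-1} ++ ... ++ Y_1 ++ E.

module _ {m : ℕ} where

  G : (n : ℕ) → (Fin n → ℕ) → ℕ
  G zero    s = m
  G (suc n) s = s (fromℕ n) + G n (λ i → s (inject₁ i))

  H : (n : ℕ) → (Fin n → ℕ) → ℕ
  H zero    s = 0
  H (suc n) s = s (fromℕ n) + H n (λ i → s (inject₁ i))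

  padE : (n : ℕ) (s : Fin n → ℕ) → Subset m → Subset (G n s)
  padE zero    s X = X
  padE (suc n) s X = replicate (s (fromℕ n)) outside ++ padE n (λ i → s (inject₁ i)) X

  embedY : (n : ℕ) (s : Fin n → ℕ) → Subset (H n s) → Subset (G n s)
  embedY zero    s []  = replicate m outside
  embedY (suc n) s Y with splitAt (s (fromℕ n)) Y
  ... | a , b , _ = a ++ embedY n (λ i → s (inject₁ i)) b

  build : (r : Rk m) (n : ℕ) (s : Fin n → ℕ) (X : Fin n → Subset m) → Rk (G n s)
  build r zero    s X = r
  build r (suc n) s X =
    freeAddMany (s (fromℕ n))
      (build r n (λ i → s (inject₁ i)) (λ i → X (inject₁ i)))
      (padE n (λ i → s (inject₁ i)) (X (fromℕ n)))

  ySet : (n : ℕ) (s : Fin n → ℕ) → Subset n → Subset (H n s)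
  ySet zero    s J = []
  ySet (suc n) s J = replicate (s (fromℕ n)) (last J) ++ ySet n (λ i → s (inject₁ i)) (init J)

unionF : ∀ {n p} → (Fin n → Subset p) → Subset n → Subset p
unionF {zero}  W []      = ⊥
unionF {suc n} W (b ∷ J) = (if b then W Fin.zero else ⊥) ∪ unionF (λ i → W (Fin.suc i)) J

record IsPartition {m n : ℕ} (X : Fin n → Subset m) : Set where
  field
    nonempty : ∀ i → ∃ λ e → e ∈ X i
    disjoint : ∀ i j → i ≢ j → X i ∩ X j ≡ ⊥
    covers   : ∀ e → ∃ λ i → e ∈ X i

coreSizes : ∀ {m n} → Rk m → (Fin n → Subset m) → Fin n → ℕ
coreSizes r X i = conn r (X i)

coreSize : ∀ {m n} → Rk m → (Fin n → Subset m) → ℕ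
coreSize {m} {n} r X = H {m} n (coreSizes r X)

-- rank function of M̂ = M_n \ E
coreRk : ∀ {m n} (r : Rk m) (X : Fin n → Subset m) → Rk (coreSize r X)
coreRk {m} {n} r X Y = build r n (coreSizes r X) X (embedY {m} n (coreSizes r X) Y)

coreBlock : ∀ {m n} (r : Rk m) (X : Fin n → Subset m) → Fin n → Subset (coreSize r X)
coreBlock {m} {n} r X i = ySet {m} n (coreSizes r X) ⁅ i ⁆

Disjoint : ∀ {n} → Subset n → Subset n → Set
Disjoint J K = J ∩ K ≡ ⊥

{-# OPTIONS --safe #-}
-- Write c(X) = r(Z ∪ X) + r((E − Z) ∪ X) − r(E) − r(X) for λ_{N/X}(Z − X).  Adding a set S freely into the
-- guts of Z gives r(S ∪ X) = r(X) + min(|S|, c(X)), because every new element that raises the rank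
-- lowers c by one.  By induction on the number of blocks this yields, for every V ⊆ E,
--   r(Y_J ∪ V) + Σ_{j ∈ J} (r(E) − r((E − X_j) ∪ V)) = r(X_J ∪ V);
-- V has to be arbitrary since the step for X_k uses the hypothesis at V, X_k ∪ V and (E − X_k) ∪ V.
-- For V = ∅ the ranks of Y_J and X_J differ by a modular function of J, which cancels from λ, ⊓ and ⊓*.
-- The clone property holds because the rank depends only on |S ∩ Y_i| for each i.
module Submission where

open import Defs
open import Data.Nat using (ℕ; zero; suc; _+_; _∸_; _≤_; _⊓_; s≤s)
open import Data.Nat.Properties
open import Data.Nat.Tactic.RingSolver using (solve-∀)
open import Data.Bool using (Bool; true; false; not; _∧_; _∨_; if_then_else_)
import Data.Bool.Properties as Bool
open import Data.Fin using (Fin; fromℕ; inject₁)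
import Data.Fin as Fin
import Data.Fin.Properties as Fin
open import Data.Fin.Permutation using (Permutation′; _⟨$⟩ʳ_; _⟨$⟩ˡ_; inverseˡ; flip)
open import Data.Fin.Relation.Unary.Top using (view; ‵fromℕ; ‵inject₁)
open import Data.Fin.Subset
  using (Subset; inside; outside; _∈_; _∉_; _⊆_; _∪_; _∩_; ∁; ⊥; ⊤; ∣_∣; ⁅_⁆; Nonempty)
open import Data.Fin.Subset.Properties
open import Data.Vec
  using (Vec; []; _∷_; _++_; replicate; tabulate; lookup; init; last; here; there; sum; map; zipWith; splitAt)
open import Data.Vec.Properties
open import Data.Product using (_,_; _×_; ∃; proj₂)
open import Data.Sum using (_⊎_; inj₁; inj₂; map₂)
open import Relation.Nullary using (Dec; yes; no; contradiction)
open import Relation.Nullary.Decidable using (True; toWitness)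
open import Relation.Binary.PropositionalEquality
open import Function using (_∘_)
open import Algebra.Properties.CommutativeMonoid.Sum +-0-commutativeMonoid
  using (sum-permute) renaming (sum to ∑)
open import Algebra.Properties.CommutativeSemigroup +-commutativeSemigroup
  using (interchange; x∙yz≈y∙xz; xy∙z≈xz∙y)

open IsMatroid

-- A decision procedure for identities between Boolean combinations of three subsets

-- The correction terms come from the cap in the minimum. A whole block Y_k has λ(X_k) elements, at
-- least as many as c, so adding it to W = Y_J ∪ V gives rank r(X_k ∪ W) + r((E' - X_k) ∪ W) -
-- r(E'), where E' is the ground set reached so far. Here E' - X_k contains every earlier Y_j, but
-- their corrections vanish because (E - X_j) ∪ (E - X_k) = E, and the middle term is just r((E -
-- X_k) ∪ V). Hence trading X_k for Y_k costs r(E) - r((E - X_k) ∪ V), whatever J is. The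
-- connectivity of a contraction is defined with truncated subtraction. Its additive form needs
-- submodularity in every intermediate matroid, so the free extension must first be shown to be a
-- matroid.

data Term : Set where
  𝐱 𝐲 𝐳 𝟏  : Term
  ∁ᵗ       : Term → Term
  _∪ᵗ_ _∩ᵗ_ : Term → Term → Term

infixr 6 _∪ᵗ_
infixr 7 _∩ᵗ_

⟦_⟧ᵇ : Term → Bool → Bool → Bool → Bool
⟦ 𝐱 ⟧ᵇ      a b c = a
⟦ 𝐲 ⟧ᵇ      a b c = b
⟦ 𝐳 ⟧ᵇ      a b c = c
⟦ 𝟏 ⟧ᵇ      a b c = true
⟦ ∁ᵗ t ⟧ᵇ   a b c = not (⟦ t ⟧ᵇ a b c)
⟦ t ∪ᵗ u ⟧ᵇ a b c = ⟦ t ⟧ᵇ a b c ∨ ⟦ u ⟧ᵇ a b c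
⟦ t ∩ᵗ u ⟧ᵇ a b c = ⟦ t ⟧ᵇ a b c ∧ ⟦ u ⟧ᵇ a b c

⟦_⟧ : Term → ∀ {p} → Subset p → Subset p → Subset p → Subset p
⟦ 𝐱 ⟧      A B C = A
⟦ 𝐲 ⟧      A B C = B
⟦ 𝐳 ⟧      A B C = C
⟦ 𝟏 ⟧      A B C = ⊤
⟦ ∁ᵗ t ⟧   A B C = ∁ (⟦ t ⟧ A B C)
⟦ t ∪ᵗ u ⟧ A B C = ⟦ t ⟧ A B C ∪ ⟦ u ⟧ A B C
⟦ t ∩ᵗ u ⟧ A B C = ⟦ t ⟧ A B C ∩ ⟦ u ⟧ A B C

⟦⟧-∷ : ∀ t {p} a b c (A B C : Subset p) →
       ⟦ t ⟧ (a ∷ A) (b ∷ B) (c ∷ C) ≡ ⟦ t ⟧ᵇ a b c ∷ ⟦ t ⟧ A B C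
⟦⟧-∷ 𝐱        a b c A B C = refl
⟦⟧-∷ 𝐲        a b c A B C = refl
⟦⟧-∷ 𝐳        a b c A B C = refl
⟦⟧-∷ 𝟏        a b c A B C = refl
⟦⟧-∷ (∁ᵗ t)   a b c A B C = cong ∁ (⟦⟧-∷ t a b c A B C)
⟦⟧-∷ (t ∪ᵗ u) a b c A B C = cong₂ _∪_ (⟦⟧-∷ t a b c A B C) (⟦⟧-∷ u a b c A B C)
⟦⟧-∷ (t ∩ᵗ u) a b c A B C = cong₂ _∩_ (⟦⟧-∷ t a b c A B C) (⟦⟧-∷ u a b c A B C)

Tautology : Term → Term → Set
Tautology t u = ∀ a b c → ⟦ t ⟧ᵇ a b c ≡ ⟦ u ⟧ᵇ a b c

all-Bool? : ∀ {P : Bool → Set} → (∀ b → Dec (P b)) → Dec (∀ b → P b)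
all-Bool? P? with P? true | P? false
... | yes pt | yes pf = yes λ { true → pt ; false → pf }
... | no ¬pt | _      = no λ f → ¬pt (f true)
... | yes _  | no ¬pf = no λ f → ¬pf (f false)

tautology? : ∀ t u → Dec (Tautology t u)
tautology? t u = all-Bool? λ a → all-Bool? λ b → all-Bool? λ c →
  ⟦ t ⟧ᵇ a b c Bool.≟ ⟦ u ⟧ᵇ a b c

tautology-sound : ∀ t u → Tautology t u → ∀ {p} (A B C : Subset p) → ⟦ t ⟧ A B C ≡ ⟦ u ⟧ A B C
tautology-sound t u h []      []      []      with ⟦ t ⟧ [] [] [] | ⟦ u ⟧ [] [] []
... | [] | [] = refl
tautology-sound t u h (a ∷ A) (b ∷ B) (c ∷ C) = begin
  ⟦ t ⟧ (a ∷ A) (b ∷ B) (c ∷ C)  ≡⟨ ⟦⟧-∷ t a b c A B C ⟩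
  ⟦ t ⟧ᵇ a b c ∷ ⟦ t ⟧ A B C     ≡⟨ cong₂ _∷_ (h a b c) (tautology-sound t u h A B C) ⟩
  ⟦ u ⟧ᵇ a b c ∷ ⟦ u ⟧ A B C     ≡⟨ ⟦⟧-∷ u a b c A B C ⟨
  ⟦ u ⟧ (a ∷ A) (b ∷ B) (c ∷ C)  ∎
  where open ≡-Reasoning

-- When the eight valuations agree, `True (tautology? t u)` reduces to the unit type, so the
-- implicit argument is found by evaluation.
boolean : ∀ t u {_ : True (tautology? t u)} {p} (A B C : Subset p) → ⟦ t ⟧ A B C ≡ ⟦ u ⟧ A B C
boolean t u {h} = tautology-sound t u (toWitness h)

-- Matroids and the guts of a set

module _ {p} {r : Rk p} (M : IsMatroid r) where

  rank-∪ˡ : ∀ A B → r A ≤ r (A ∪ B)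
  rank-∪ˡ A B = monotone M A (A ∪ B) (p⊆p∪q B)

  rank-∪ʳ : ∀ A B → r B ≤ r (A ∪ B)
  rank-∪ʳ A B = monotone M B (A ∪ B) (q⊆p∪q A B)

  submodular′ : ∀ A B {C D} → A ∪ B ≡ C → A ∩ B ≡ D → r C + r D ≤ r A + r B
  submodular′ A B refl refl = submodular M A B

  rank-∪-≤ : ∀ A B → r (A ∪ B) ≤ ∣ A ∣ + r B
  rank-∪-≤ A B = begin
    r (A ∪ B)              ≤⟨ m≤m+n _ _ ⟩
    r (A ∪ B) + r (A ∩ B)  ≤⟨ submodular M A B ⟩
    r A + r B              ≤⟨ +-monoˡ-≤ (r B) (bounded M A) ⟩
    ∣ A ∣ + r B            ∎
    where open ≤-Reasoning

guts : ∀ {p} → Rk p → Subset p → Subset p → ℕ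
guts r Z X = connContract r X (Z ∩ ∁ X)

gutsSum : ∀ {p} → Rk p → Subset p → Subset p → ℕ
gutsSum r Z X = r (Z ∪ X) + r (∁ Z ∪ X)

-- This is the shape of the connectivity of a contraction, where `x` is the rank of the contracted
-- set. The hypotheses make all four truncated subtractions exact.
∸-cancel-common : ∀ {x a b t} → x ≤ a → x ≤ b → x ≤ t → t + x ≤ a + b →
                  ((a ∸ x) + (b ∸ x) ∸ (t ∸ x)) + (t + x) ≡ a + b
∸-cancel-common {x} x≤a x≤b x≤t t+x≤a+b
  with a , refl ← m≤n⇒∃[o]m+o≡n x≤a
     | b , refl ← m≤n⇒∃[o]m+o≡n x≤b
     | t , refl ← m≤n⇒∃[o]m+o≡n x≤t
  rewrite m+n∸m≡n x a | m+n∸m≡n x b | m+n∸m≡n x t = begin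
  (a + b ∸ t) + (x + t + x)    ≡⟨ shuffle (a + b ∸ t) t x ⟩
  (a + b ∸ t + t) + (x + x)    ≡⟨ cong (_+ (x + x)) (m∸n+n≡m t≤a+b) ⟩
  (a + b) + (x + x)            ≡⟨ shuffle′ a b x ⟩
  (x + a) + (x + b)            ∎
  where
  open ≡-Reasoning
  shuffle : ∀ c t x → c + (x + t + x) ≡ (c + t) + (x + x)
  shuffle = solve-∀
  shuffle′ : ∀ a b x → (a + b) + (x + x) ≡ (x + a) + (x + b)
  shuffle′ = solve-∀
  t≤a+b : t ≤ a + b
  t≤a+b = +-cancelʳ-≤ (x + x) t (a + b)
    (subst₂ _≤_ (shuffle 0 t x) (sym (shuffle′ a b x)) t+x≤a+b)

module _ {p} {r : Rk p} (M : IsMatroid r) (Z : Subset p) where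

  -- The sets `Z ∪ X` and `∁ Z ∪ X` cover the ground set and meet in `X`, so submodularity rules out
  -- truncation. Later rank calculations go through this additive form.
  guts-eq : ∀ X → guts r Z X + (r ⊤ + r X) ≡ gutsSum r Z X
  guts-eq X
    rewrite boolean ((𝐱 ∩ᵗ ∁ᵗ 𝐲) ∪ᵗ 𝐲) (𝐱 ∪ᵗ 𝐲) Z X X
          | boolean ((∁ᵗ (𝐱 ∩ᵗ ∁ᵗ 𝐲) ∩ᵗ ∁ᵗ 𝐲) ∪ᵗ 𝐲) (∁ᵗ 𝐱 ∪ᵗ 𝐲) Z X X
          | boolean (∁ᵗ 𝐲 ∪ᵗ 𝐲) 𝟏 Z X X
    = ∸-cancel-common (rank-∪ʳ M Z X) (rank-∪ʳ M (∁ Z) X) (monotone M X ⊤ ⊆⊤)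
        (submodular′ M (Z ∪ X) (∁ Z ∪ X)
          (boolean ((𝐱 ∪ᵗ 𝐲) ∪ᵗ (∁ᵗ 𝐱 ∪ᵗ 𝐲)) 𝟏 Z X X)
          (boolean ((𝐱 ∪ᵗ 𝐲) ∩ᵗ (∁ᵗ 𝐱 ∪ᵗ 𝐲)) 𝐲 Z X X))

  rank-complement : r ⊤ ≤ r Z + r (∁ Z)
  rank-complement = ≤-trans (m≤m+n _ _) (submodular′ M Z (∁ Z) (p∪∁p≡⊤ Z) refl)

  conn-eq : conn r Z + r ⊤ ≡ r Z + r (∁ Z)
  conn-eq = m∸n+n≡m rank-complement

  -- Contraction does not raise connectivity: submodularity is applied to `Z` and `X`, to `∁ Z` and
  -- `X`, and to the two parts into which `Z` cuts `X`. It ensures that λ elements are enough to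
  -- reach the cap.
  guts≤conn : ∀ X → guts r Z X ≤ conn r Z
  guts≤conn X = +-cancelʳ-≤ (r ⊤ + r X + r X) _ _ (begin
    guts r Z X + (r ⊤ + r X + r X)              ≡⟨ shuffle (guts r Z X) (r ⊤) (r X) ⟩
    guts r Z X + (r ⊤ + r X) + r X              ≡⟨ cong (_+ r X) (guts-eq X) ⟩
    gutsSum r Z X + r X                             ≤⟨ +-monoʳ-≤ (gutsSum r Z X) split ⟩
    gutsSum r Z X + (r (Z ∩ X) + r (∁ Z ∩ X))       ≡⟨ interchange (r (Z ∪ X)) _ _ _ ⟩
    (r (Z ∪ X) + r (Z ∩ X)) + (r (∁ Z ∪ X) + r (∁ Z ∩ X))
      ≤⟨ +-mono-≤ (submodular M Z X) (submodular M (∁ Z) X) ⟩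
    (r Z + r X) + (r (∁ Z) + r X)               ≡⟨ collect (r Z) (r X) (r (∁ Z)) ⟩
    (r Z + r (∁ Z)) + (r X + r X)               ≡⟨ cong (_+ (r X + r X)) conn-eq ⟨
    (conn r Z + r ⊤) + (r X + r X)              ≡⟨ regroup (conn r Z) (r ⊤) (r X) ⟩
    conn r Z + (r ⊤ + r X + r X)                ∎)
    where
    open ≤-Reasoning
    split : r X ≤ r (Z ∩ X) + r (∁ Z ∩ X)
    split = ≤-trans (m≤m+n _ _)
      (submodular′ M (Z ∩ X) (∁ Z ∩ X) (boolean ((𝐱 ∩ᵗ 𝐲) ∪ᵗ (∁ᵗ 𝐱 ∩ᵗ 𝐲)) 𝐲 Z X X) refl)
    shuffle : ∀ g t x → g + (t + x + x) ≡ g + (t + x) + x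
    shuffle = solve-∀
    collect : ∀ z x w → (z + x) + (w + x) ≡ (z + w) + (x + x)
    collect = solve-∀
    regroup : ∀ k t x → (k + t) + (x + x) ≡ k + (t + x + x)
    regroup = solve-∀

  guts-vanishes : ∀ X → gutsSum r Z X ≡ r ⊤ + r X → guts r Z X ≡ 0
  guts-vanishes X eq = +-cancelʳ-≡ (r ⊤ + r X) (guts r Z X) 0 (trans (guts-eq X) eq)

-- Free addition into the guts

gutsStep-⊓ : ∀ c k → gutsStep c k ≡ k + 1 ⊓ c
gutsStep-⊓ zero    k = sym (+-identityʳ k)
gutsStep-⊓ (suc c) k = +-comm 1 k

module FreeAdd {p} {r : Rk p} (M : IsMatroid r) (Z : Subset p) where

  r⁺ : Subset p → ℕ
  r⁺ X = freeAdd1 r Z (true ∷ X)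

  S : Subset p → ℕ
  S = gutsSum r Z

  r≤r⁺ : ∀ X → r X ≤ r⁺ X
  r≤r⁺ X = subst (r X ≤_) (sym (gutsStep-⊓ (guts r Z X) (r X))) (m≤m+n (r X) _)

  r⁺≤1+r : ∀ X → r⁺ X ≤ suc (r X)
  r⁺≤1+r X with guts r Z X
  ... | zero  = n≤1+n (r X)
  ... | suc _ = ≤-refl

  -- The order of the summands matters: once `guts r Z X` is matched with `zero`, the left side
  -- computes to `r X + r ⊤`.
  guts+r : ∀ X → guts r Z X + r X + r ⊤ ≡ S X
  guts+r X = trans (shuffle (guts r Z X) (r X) (r ⊤)) (guts-eq M Z X)
    where
    shuffle : ∀ g x t → g + x + t ≡ g + (t + x)
    shuffle = solve-∀

  -- Behind this is that `r⁺ X` is the minimum of `suc (r X)` and `S X - r ⊤`. Here one of the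
  -- bounds is attained; `r⁺≤1+r` and `r⁺-upper` give the bounds and `r⁺-greatest` the universal
  -- property, all without subtraction.
  r⁺-cases : ∀ X → r⁺ X ≡ suc (r X) ⊎ r⁺ X + r ⊤ ≡ S X
  r⁺-cases X with guts r Z X | guts+r X
  ... | zero  | eq = inj₂ eq
  ... | suc _ | eq = inj₁ refl

  r⁺-upper : ∀ X → r⁺ X + r ⊤ ≤ S X
  r⁺-upper X with guts r Z X | guts+r X
  ... | zero  | eq = ≤-reflexive eq
  ... | suc g | eq = subst (suc (r X + r ⊤) ≤_) eq (s≤s (+-monoˡ-≤ (r ⊤) (m≤n+m (r X) g)))

  r⁺-greatest : ∀ X k → k ≤ suc (r X) → k + r ⊤ ≤ S X → k ≤ r⁺ X
  r⁺-greatest X k k≤ k+≤ with guts r Z X | guts+r X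
  ... | zero  | eq = +-cancelʳ-≤ (r ⊤) k (r X) (subst (k + r ⊤ ≤_) (sym eq) k+≤)
  ... | suc _ | eq = k≤

  -- Two submodular inequalities are chained through `(Z ∪ X) ∩ Y`, whose rank `k` cancels. It is
  -- the intersection in the first and replaces `Y` in the second, so that only one `r Y` is spent
  -- on both sides of `Z`.
  S-exchange : ∀ X Y → S (X ∪ Y) + r (X ∩ Y) ≤ S X + r Y
  S-exchange X Y = +-cancelʳ-≤ k _ _ (begin
    (r (Z ∪ X ∪ Y) + r (∁ Z ∪ X ∪ Y)) + r (X ∩ Y) + k
      ≡⟨ rearrange (r (Z ∪ X ∪ Y)) _ _ k ⟩
    (r (Z ∪ X ∪ Y) + k) + (r (∁ Z ∪ X ∪ Y) + r (X ∩ Y))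
      ≤⟨ +-mono-≤
           (submodular′ M (Z ∪ X) Y (boolean ((𝐱 ∪ᵗ 𝐲) ∪ᵗ 𝐳) (𝐱 ∪ᵗ 𝐲 ∪ᵗ 𝐳) Z X Y) refl)
           (submodular′ M (∁ Z ∪ X) ((Z ∪ X) ∩ Y)
             (boolean ((∁ᵗ 𝐱 ∪ᵗ 𝐲) ∪ᵗ ((𝐱 ∪ᵗ 𝐲) ∩ᵗ 𝐳)) (∁ᵗ 𝐱 ∪ᵗ 𝐲 ∪ᵗ 𝐳) Z X Y)
             (boolean ((∁ᵗ 𝐱 ∪ᵗ 𝐲) ∩ᵗ ((𝐱 ∪ᵗ 𝐲) ∩ᵗ 𝐳)) (𝐲 ∩ᵗ 𝐳) Z X Y)) ⟩
    (r (Z ∪ X) + r Y) + (r (∁ Z ∪ X) + k)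
      ≡⟨ rearrange′ (r (Z ∪ X)) _ _ k ⟩
    (r (Z ∪ X) + r (∁ Z ∪ X)) + r Y + k
      ∎)
    where
    open ≤-Reasoning
    k = r ((Z ∪ X) ∩ Y)
    rearrange : ∀ a b c k → (a + b) + c + k ≡ (a + k) + (b + c)
    rearrange = solve-∀
    rearrange′ : ∀ a y b k → (a + y) + (b + k) ≡ (a + b) + y + k
    rearrange′ = solve-∀

  S-submodular : ∀ X Y → S (X ∪ Y) + S (X ∩ Y) ≤ S X + S Y
  S-submodular X Y = subst₂ _≤_
    (interchange (r (Z ∪ X ∪ Y)) _ _ _) (interchange (r (Z ∪ X)) _ _ _)
    (+-mono-≤
      (submodular′ M (Z ∪ X) (Z ∪ Y)
        (boolean ((𝐱 ∪ᵗ 𝐲) ∪ᵗ (𝐱 ∪ᵗ 𝐳)) (𝐱 ∪ᵗ 𝐲 ∪ᵗ 𝐳) Z X Y)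
        (boolean ((𝐱 ∪ᵗ 𝐲) ∩ᵗ (𝐱 ∪ᵗ 𝐳)) (𝐱 ∪ᵗ 𝐲 ∩ᵗ 𝐳) Z X Y))
      (submodular′ M (∁ Z ∪ X) (∁ Z ∪ Y)
        (boolean ((∁ᵗ 𝐱 ∪ᵗ 𝐲) ∪ᵗ (∁ᵗ 𝐱 ∪ᵗ 𝐳)) (∁ᵗ 𝐱 ∪ᵗ 𝐲 ∪ᵗ 𝐳) Z X Y)
        (boolean ((∁ᵗ 𝐱 ∪ᵗ 𝐲) ∩ᵗ (∁ᵗ 𝐱 ∪ᵗ 𝐳)) (∁ᵗ 𝐱 ∪ᵗ 𝐲 ∩ᵗ 𝐳) Z X Y)))

  r⁺-bounded : ∀ X → r⁺ X ≤ suc ∣ X ∣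
  r⁺-bounded X = ≤-trans (r⁺≤1+r X) (s≤s (bounded M X))

  r⁺-monotone : ∀ X Y → X ⊆ Y → r⁺ X ≤ r⁺ Y
  r⁺-monotone X Y X⊆Y = r⁺-greatest Y (r⁺ X)
    (≤-trans (r⁺≤1+r X) (s≤s (monotone M X Y X⊆Y)))
    (≤-trans (r⁺-upper X) (+-mono-≤ (mono Z) (mono (∁ Z))))
    where
    mono : ∀ W → r (W ∪ X) ≤ r (W ∪ Y)
    mono W = monotone M (W ∪ X) (W ∪ Y) λ e∈ → x∈p∪q⁺ (map₂ X⊆Y (x∈p∪q⁻ W X e∈))

  -- This is submodularity of the extension when only the first set contains the new element. Which
  -- bound is attained at `X` decides between submodularity of `r` and `S-exchange`.
  r⁺-exchange : ∀ X Y → r⁺ (X ∪ Y) + r (X ∩ Y) ≤ r⁺ X + r Y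
  r⁺-exchange X Y with r⁺-cases X
  ... | inj₁ eq = begin
    r⁺ (X ∪ Y) + r (X ∩ Y)       ≤⟨ +-monoˡ-≤ (r (X ∩ Y)) (r⁺≤1+r (X ∪ Y)) ⟩
    suc (r (X ∪ Y)) + r (X ∩ Y)  ≤⟨ s≤s (submodular M X Y) ⟩
    suc (r X) + r Y              ≡⟨ cong (_+ r Y) eq ⟨
    r⁺ X + r Y                   ∎
    where open ≤-Reasoning
  ... | inj₂ eq = +-cancelʳ-≤ (r ⊤) _ _ (begin
    r⁺ (X ∪ Y) + r (X ∩ Y) + r ⊤    ≡⟨ xy∙z≈xz∙y (r⁺ (X ∪ Y)) _ _ ⟩
    r⁺ (X ∪ Y) + r ⊤ + r (X ∩ Y)    ≤⟨ +-monoˡ-≤ (r (X ∩ Y)) (r⁺-upper (X ∪ Y)) ⟩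
    S (X ∪ Y) + r (X ∩ Y)           ≤⟨ S-exchange X Y ⟩
    S X + r Y                       ≡⟨ cong (_+ r Y) eq ⟨
    r⁺ X + r ⊤ + r Y                ≡⟨ xy∙z≈xz∙y (r⁺ X) _ _ ⟩
    r⁺ X + r Y + r ⊤                ∎)
    where
    open ≤-Reasoning

  -- The unit gained at `Y` pays for the at most one unit gained at `X ∩ Y`, which reduces the claim
  -- to `r⁺-exchange`.
  r⁺-submodular-suc : ∀ X Y → r⁺ Y ≡ suc (r Y) → r⁺ (X ∪ Y) + r⁺ (X ∩ Y) ≤ r⁺ X + r⁺ Y
  r⁺-submodular-suc X Y eq = begin
    r⁺ (X ∪ Y) + r⁺ (X ∩ Y)       ≤⟨ +-monoʳ-≤ (r⁺ (X ∪ Y)) (r⁺≤1+r (X ∩ Y)) ⟩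
    r⁺ (X ∪ Y) + suc (r (X ∩ Y))  ≡⟨ +-suc _ _ ⟩
    suc (r⁺ (X ∪ Y) + r (X ∩ Y))  ≤⟨ s≤s (r⁺-exchange X Y) ⟩
    suc (r⁺ X + r Y)              ≡⟨ +-suc _ _ ⟨
    r⁺ X + suc (r Y)              ≡⟨ cong (r⁺ X +_) eq ⟨
    r⁺ X + r⁺ Y                   ∎
    where open ≤-Reasoning

  r⁺-submodular : ∀ X Y → r⁺ (X ∪ Y) + r⁺ (X ∩ Y) ≤ r⁺ X + r⁺ Y
  r⁺-submodular X Y with r⁺-cases X | r⁺-cases Y
  ... | _       | inj₁ eq = r⁺-submodular-suc X Y eq
  ... | inj₁ eq | inj₂ _
    rewrite ∪-comm X Y | ∩-comm X Y | +-comm (r⁺ X) (r⁺ Y) = r⁺-submodular-suc Y X eq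
  ... | inj₂ eqX | inj₂ eqY = +-cancelʳ-≤ (r ⊤ + r ⊤) _ _ (begin
    r⁺ (X ∪ Y) + r⁺ (X ∩ Y) + (r ⊤ + r ⊤)      ≡⟨ interchange (r⁺ (X ∪ Y)) _ _ _ ⟩
    (r⁺ (X ∪ Y) + r ⊤) + (r⁺ (X ∩ Y) + r ⊤)    ≤⟨ +-mono-≤ (r⁺-upper (X ∪ Y)) (r⁺-upper (X ∩ Y)) ⟩
    S (X ∪ Y) + S (X ∩ Y)                      ≤⟨ S-submodular X Y ⟩
    S X + S Y                                  ≡⟨ cong₂ _+_ eqX eqY ⟨
    (r⁺ X + r ⊤) + (r⁺ Y + r ⊤)                ≡⟨ interchange (r⁺ X) _ _ _ ⟩
    r⁺ X + r⁺ Y + (r ⊤ + r ⊤)                  ∎)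
    where
    open ≤-Reasoning

  freeAdd1-isMatroid : IsMatroid (freeAdd1 r Z)
  freeAdd1-isMatroid .bounded (true  ∷ X) = r⁺-bounded X
  freeAdd1-isMatroid .bounded (false ∷ X) = bounded M X
  freeAdd1-isMatroid .monotone (true  ∷ X) (true  ∷ Y) X⊆Y = r⁺-monotone X Y (drop-∷-⊆ X⊆Y)
  freeAdd1-isMatroid .monotone (false ∷ X) (true  ∷ Y) X⊆Y =
    ≤-trans (monotone M X Y (drop-∷-⊆ X⊆Y)) (r≤r⁺ Y)
  freeAdd1-isMatroid .monotone (false ∷ X) (false ∷ Y) X⊆Y = monotone M X Y (drop-∷-⊆ X⊆Y)
  freeAdd1-isMatroid .monotone (true  ∷ X) (false ∷ Y) X⊆Y with () ← X⊆Y here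
  freeAdd1-isMatroid .submodular (true  ∷ X) (true  ∷ Y) = r⁺-submodular X Y
  freeAdd1-isMatroid .submodular (true  ∷ X) (false ∷ Y) = r⁺-exchange X Y
  freeAdd1-isMatroid .submodular (false ∷ X) (true  ∷ Y)
    rewrite ∪-comm X Y | ∩-comm X Y | +-comm (r X) (r⁺ Y) = r⁺-exchange Y X
  freeAdd1-isMatroid .submodular (false ∷ X) (false ∷ Y) = submodular M X Y

open FreeAdd using (freeAdd1-isMatroid)

freeAddMany-isMatroid : ∀ {p} {r : Rk p} → IsMatroid r → ∀ Z s → IsMatroid (freeAddMany s r Z)
freeAddMany-isMatroid M Z zero    = M
freeAddMany-isMatroid M Z (suc s) = freeAdd1-isMatroid (freeAddMany-isMatroid M Z s) _

-- Adding a whole set into the guts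

∁⊥≡⊤ : ∀ {p} → ∁ (⊥ {p}) ≡ ⊤
∁⊥≡⊤ {p} = map-replicate not outside p

replicate-++ : ∀ {A : Set} s {p} (x : A) → replicate (s + p) x ≡ replicate s x ++ replicate p x
replicate-++ zero    x = refl
replicate-++ (suc s) x = cong (x ∷_) (replicate-++ s x)

∪-++ : ∀ {s p} (S S′ : Subset s) (X X′ : Subset p) → (S ++ X) ∪ (S′ ++ X′) ≡ (S ∪ S′) ++ (X ∪ X′)
∪-++ S S′ X X′ = zipWith-++ _∨_ S X S′ X′

∁-pad : ∀ s {p} (Z : Subset p) → ∁ (⊥ {s} ++ Z) ≡ ⊤ {s} ++ ∁ Z
∁-pad s Z = trans (map-++ not ⊥ Z) (cong (_++ ∁ Z) (map-replicate not outside s))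

pad-∪ : ∀ {s p} (Z : Subset p) (S : Subset s) X → (⊥ {s} ++ Z) ∪ (S ++ X) ≡ S ++ (Z ∪ X)
pad-∪ Z S X = trans (∪-++ ⊥ S Z X) (cong (_++ (Z ∪ X)) (∪-identityˡ S))

-- The added elements lie outside the padded `Z`, so the complementary side contains all of them,
-- whatever `S` is.
∁-pad-∪ : ∀ {s p} (Z : Subset p) (S : Subset s) X → ∁ (⊥ {s} ++ Z) ∪ (S ++ X) ≡ ⊤ {s} ++ (∁ Z ∪ X)
∁-pad-∪ {s} Z S X = begin
  ∁ (⊥ ++ Z) ∪ (S ++ X)  ≡⟨ cong (_∪ (S ++ X)) (∁-pad s Z) ⟩
  (⊤ ++ ∁ Z) ∪ (S ++ X)  ≡⟨ ∪-++ ⊤ S (∁ Z) X ⟩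
  (⊤ ∪ S) ++ (∁ Z ∪ X)   ≡⟨ cong (_++ (∁ Z ∪ X)) (∪-zeroˡ S) ⟩
  ⊤ ++ (∁ Z ∪ X)         ∎
  where open ≡-Reasoning

-- Here `g` is the connectivity before any addition and `c` what is left of it after `n` elements. A
-- further element raises the rank exactly while something is left.
⊓-step : ∀ n g c → c + n ⊓ g ≡ g → n ⊓ g + 1 ⊓ c ≡ suc n ⊓ g
⊓-step zero    g       c eq = cong (1 ⊓_) (trans (sym (+-identityʳ c)) eq)
⊓-step (suc n) zero    c eq = cong (1 ⊓_) (trans (sym (+-identityʳ c)) eq)
⊓-step (suc n) (suc g) c eq =
  cong suc (⊓-step n g c (suc-injective (trans (sym (+-suc c (n ⊓ g))) eq)))

module _ {p} {r : Rk p} (M : IsMatroid r) (Z : Subset p) where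

  -- Once one whole side is contracted, nothing remains there to be connected to the other. Such a
  -- set therefore spans every element added into the guts; the same holds for `guts-∁∪ˡ`.
  guts-∪ˡ : ∀ X → guts r Z (Z ∪ X) ≡ 0
  guts-∪ˡ X = guts-vanishes M Z (Z ∪ X) (trans (+-comm (r (Z ∪ Z ∪ X)) _) (cong₂ _+_
    (cong r (boolean (∁ᵗ 𝐱 ∪ᵗ 𝐱 ∪ᵗ 𝐲) 𝟏 Z X X))
    (cong r (boolean (𝐱 ∪ᵗ 𝐱 ∪ᵗ 𝐲) (𝐱 ∪ᵗ 𝐲) Z X X))))

  guts-∁∪ˡ : ∀ X → guts r Z (∁ Z ∪ X) ≡ 0
  guts-∁∪ˡ X = guts-vanishes M Z (∁ Z ∪ X) (cong₂ _+_
    (cong r (boolean (𝐱 ∪ᵗ ∁ᵗ 𝐱 ∪ᵗ 𝐲) 𝟏 Z X X))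
    (cong r (boolean (∁ᵗ 𝐱 ∪ᵗ ∁ᵗ 𝐱 ∪ᵗ 𝐲) (∁ᵗ 𝐱 ∪ᵗ 𝐲) Z X X)))

  guts-⊤ : guts r Z ⊤ ≡ 0
  guts-⊤ = trans (cong (guts r Z) (sym (boolean (∁ᵗ 𝐱 ∪ᵗ 𝐱) 𝟏 Z Z Z))) (guts-∁∪ˡ Z)

  freeAddMany-++ : ∀ s (S : Subset s) X → freeAddMany s r Z (S ++ X) ≡ r X + ∣ S ∣ ⊓ guts r Z X
  freeAddMany-++ zero    []          X = sym (+-identityʳ (r X))
  freeAddMany-++ (suc s) (false ∷ S) X = freeAddMany-++ s S X
  freeAddMany-++ (suc s) (true  ∷ S) X = begin
    gutsStep c (f (S ++ X))               ≡⟨ gutsStep-⊓ c _ ⟩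
    f (S ++ X) + 1 ⊓ c                    ≡⟨ cong (_+ 1 ⊓ c) (freeAddMany-++ s S X) ⟩
    r X + ∣ S ∣ ⊓ guts r Z X + 1 ⊓ c      ≡⟨ +-assoc (r X) _ _ ⟩
    r X + (∣ S ∣ ⊓ guts r Z X + 1 ⊓ c)    ≡⟨ cong (r X +_) (⊓-step ∣ S ∣ _ c remaining) ⟩
    r X + suc ∣ S ∣ ⊓ guts r Z X          ∎
    where
    open ≡-Reasoning
    f = freeAddMany s r Z
    Z′ = ⊥ {s} ++ Z
    c = guts f Z′ (S ++ X)
    f-eq : ∀ T W → guts r Z W ≡ 0 → f (T ++ W) ≡ r W
    f-eq T W g≡0 = trans (freeAddMany-++ s T W)
      (trans (cong (λ g → r W + ∣ T ∣ ⊓ g) g≡0)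
             (trans (cong (r W +_) (⊓-zeroʳ ∣ T ∣)) (+-identityʳ (r W))))
    shuffle : ∀ c g t x → c + g + (t + x) ≡ c + (t + (x + g))
    shuffle = solve-∀
    -- The earlier elements leave the ranks of both sides and of the ground set unchanged, by
    -- `f-eq`. Only the rank of the set itself has grown, so the connectivity has dropped by exactly
    -- that growth.
    remaining : c + ∣ S ∣ ⊓ guts r Z X ≡ guts r Z X
    remaining = +-cancelʳ-≡ (r ⊤ + r X) _ _ (begin
      c + ∣ S ∣ ⊓ guts r Z X + (r ⊤ + r X)    ≡⟨ shuffle c _ (r ⊤) (r X) ⟩
      c + (r ⊤ + (r X + ∣ S ∣ ⊓ guts r Z X))  ≡⟨ cong (c +_) (cong₂ _+_
                                                   (trans (cong f (replicate-++ s inside)) (f-eq ⊤ ⊤ guts-⊤))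
                                                   (freeAddMany-++ s S X)) ⟨
      c + (f ⊤ + f (S ++ X))                  ≡⟨ guts-eq (freeAddMany-isMatroid M Z s) Z′ (S ++ X) ⟩
      f (Z′ ∪ (S ++ X)) + f (∁ Z′ ∪ (S ++ X)) ≡⟨ cong₂ _+_
                                                   (trans (cong f (pad-∪ Z S X)) (f-eq S (Z ∪ X) (guts-∪ˡ X)))
                                                   (trans (cong f (∁-pad-∪ Z S X)) (f-eq ⊤ (∁ Z ∪ X) (guts-∁∪ˡ X))) ⟩
      r (Z ∪ X) + r (∁ Z ∪ X)                 ≡⟨ guts-eq M Z X ⟨
      guts r Z X + (r ⊤ + r X)                ∎)

-- Indexing by the last element

module _ {A B C : Set} where

  init-zipWith : ∀ (f : A → B → C) {n} (xs : Vec A (suc n)) ys →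
                 init (zipWith f xs ys) ≡ zipWith f (init xs) (init ys)
  init-zipWith f (x ∷ [])      (y ∷ [])      = refl
  init-zipWith f (x ∷ x′ ∷ xs) (y ∷ y′ ∷ ys) = cong (f x y ∷_) (init-zipWith f (x′ ∷ xs) (y′ ∷ ys))

  last-zipWith : ∀ (f : A → B → C) {n} (xs : Vec A (suc n)) ys →
                 last (zipWith f xs ys) ≡ f (last xs) (last ys)
  last-zipWith f (x ∷ [])      (y ∷ [])      = refl
  last-zipWith f (x ∷ x′ ∷ xs) (y ∷ y′ ∷ ys) = last-zipWith f (x′ ∷ xs) (y′ ∷ ys)

module _ {A B : Set} where

  init-map : ∀ (f : A → B) {n} (xs : Vec A (suc n)) → init (map f xs) ≡ map f (init xs)
  init-map f (x ∷ [])      = refl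
  init-map f (x ∷ x′ ∷ xs) = cong (f x ∷_) (init-map f (x′ ∷ xs))

  last-map : ∀ (f : A → B) {n} (xs : Vec A (suc n)) → last (map f xs) ≡ f (last xs)
  last-map f (x ∷ [])      = refl
  last-map f (x ∷ x′ ∷ xs) = last-map f (x′ ∷ xs)

init-replicate : ∀ {A : Set} n (x : A) → init (replicate (suc n) x) ≡ replicate n x
init-replicate zero    x = refl
init-replicate (suc n) x = cong (x ∷_) (init-replicate n x)

last-replicate : ∀ {A : Set} n (x : A) → last (replicate (suc n) x) ≡ x
last-replicate zero    x = refl
last-replicate (suc n) x = last-replicate n x

wsum : ∀ {n} → (Fin n → ℕ) → Subset n → ℕ
wsum w []      = 0
wsum w (b ∷ J) = (if b then w Fin.zero else 0) + wsum (w ∘ Fin.suc) J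

-- `wsum` and `unionF` recurse on the first index, whereas `build`, `full` and `ySet` recurse on the
-- last. This lemma and `unionF-snoc` reconcile the two.
wsum-snoc : ∀ {n} (w : Fin (suc n) → ℕ) J →
            wsum w J ≡ (if last J then w (fromℕ n) else 0) + wsum (w ∘ inject₁) (init J)
wsum-snoc w (b ∷ [])    = refl
wsum-snoc {suc n} w (b ∷ c ∷ J) = trans
  (cong (first +_) (wsum-snoc (w ∘ Fin.suc) (c ∷ J)))
  (x∙yz≈y∙xz first (if last (c ∷ J) then w (fromℕ (suc n)) else 0) _)
  where
  first = if b then w Fin.zero else 0

wsum-cong : ∀ {n} {w w′ : Fin n → ℕ} → (∀ i → w i ≡ w′ i) → ∀ J → wsum w J ≡ wsum w′ J
wsum-cong w≗w′ []          = refl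
wsum-cong w≗w′ (true  ∷ J) = cong₂ _+_ (w≗w′ Fin.zero) (wsum-cong (w≗w′ ∘ Fin.suc) J)
wsum-cong w≗w′ (false ∷ J) = wsum-cong (w≗w′ ∘ Fin.suc) J

wsum-zero : ∀ {n} {w : Fin n → ℕ} → (∀ i → w i ≡ 0) → ∀ J → wsum w J ≡ 0
wsum-zero w≗0 []          = refl
wsum-zero w≗0 (true  ∷ J) = cong₂ _+_ (w≗0 Fin.zero) (wsum-zero (w≗0 ∘ Fin.suc) J)
wsum-zero w≗0 (false ∷ J) = wsum-zero (w≗0 ∘ Fin.suc) J

unionF-snoc : ∀ {n p} (W : Fin (suc n) → Subset p) J →
              unionF W J ≡ (if last J then W (fromℕ n) else ⊥) ∪ unionF (W ∘ inject₁) (init J)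
unionF-snoc W (b ∷ [])    = refl
unionF-snoc {suc n} W (b ∷ c ∷ J) = trans
  (cong (first ∪_) (unionF-snoc (W ∘ Fin.suc) (c ∷ J)))
  (boolean (𝐱 ∪ᵗ 𝐲 ∪ᵗ 𝐳) (𝐲 ∪ᵗ 𝐱 ∪ᵗ 𝐳) first _ _)
  where first = if b then W Fin.zero else ⊥

unionF-disjoint : ∀ {n p} {W : Fin n → Subset p} {A} → (∀ i → W i ∩ A ≡ ⊥) → ∀ J → unionF W J ∩ A ≡ ⊥
unionF-disjoint dis []          = ∩-zeroˡ _
unionF-disjoint {W = W} {A} dis (b ∷ J) = begin
  (first b ∪ rest) ∩ A        ≡⟨ ∩-distribʳ-∪ A (first b) rest ⟩
  (first b ∩ A) ∪ (rest ∩ A)  ≡⟨ cong₂ _∪_ (first-disjoint b) (unionF-disjoint (dis ∘ Fin.suc) J) ⟩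
  ⊥ ∪ ⊥                       ≡⟨ ∪-identityˡ ⊥ ⟩
  ⊥                           ∎
  where
  open ≡-Reasoning
  first : Bool → Subset _
  first b = if b then W Fin.zero else ⊥
  rest = unionF (W ∘ Fin.suc) J
  first-disjoint : ∀ b → first b ∩ A ≡ ⊥
  first-disjoint true  = dis Fin.zero
  first-disjoint false = ∩-zeroˡ A

module _ {p} {A B : Subset p} (A∩B≡⊥ : A ∩ B ≡ ⊥) where

  -- `boolean` takes no hypotheses, so `A ∩ B` is first made to appear as a subterm and then
  -- replaced by `⊥`.
  disjoint-∁-absorbs : ∀ V → ∁ A ∪ (B ∪ V) ≡ ∁ A ∪ V
  disjoint-∁-absorbs V = begin
    ∁ A ∪ (B ∪ V)        ≡⟨ boolean (∁ᵗ 𝐱 ∪ᵗ 𝐲 ∪ᵗ 𝐳) ((𝐱 ∩ᵗ 𝐲) ∪ᵗ (∁ᵗ 𝐱 ∪ᵗ 𝐳)) A B V ⟩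
    (A ∩ B) ∪ (∁ A ∪ V)  ≡⟨ cong (_∪ (∁ A ∪ V)) A∩B≡⊥ ⟩
    ⊥ ∪ (∁ A ∪ V)        ≡⟨ ∪-identityˡ _ ⟩
    ∁ A ∪ V              ∎
    where open ≡-Reasoning

  -- For two blocks this says that the deficit of one vanishes in the presence of the complement of
  -- the other.
  disjoint-∁-covers : ∀ V → ∁ A ∪ (∁ B ∪ V) ≡ ⊤
  disjoint-∁-covers V = begin
    ∁ A ∪ (∁ B ∪ V)  ≡⟨ boolean (∁ᵗ 𝐱 ∪ᵗ ∁ᵗ 𝐲 ∪ᵗ 𝐳) (∁ᵗ (𝐱 ∩ᵗ 𝐲) ∪ᵗ 𝐳) A B V ⟩
    ∁ (A ∩ B) ∪ V    ≡⟨ cong (λ C → ∁ C ∪ V) A∩B≡⊥ ⟩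
    ∁ ⊥ ∪ V          ≡⟨ cong (_∪ V) ∁⊥≡⊤ ⟩
    ⊤ ∪ V            ≡⟨ ∪-zeroˡ V ⟩
    ⊤                ∎
    where open ≡-Reasoning

-- The rank of a union of blocks

module _ {m : ℕ} where

  -- The subset of the ground set of Mₙ consisting of the Yⱼ with j ∈ J together with V ⊆ E.
  full : ∀ n (s : Fin n → ℕ) → Subset n → Subset m → Subset (G {m} n s)
  full zero    s J V = V
  full (suc n) s J V = replicate (s (fromℕ n)) (last J) ++ full n (s ∘ inject₁) (init J) V

  full-∪ : ∀ n s J K V W → full n s J V ∪ full n s K W ≡ full n s (J ∪ K) (V ∪ W)
  full-∪ zero    s J K V W = refl
  full-∪ (suc n) s J K V W
    rewrite init-zipWith _∨_ J K | last-zipWith _∨_ J K =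
    trans (∪-++ (replicate (s (fromℕ n)) (last J)) (replicate _ (last K)) _ _)
          (cong₂ _++_ (zipWith-replicate _∨_ (last J) (last K)) (full-∪ n (s ∘ inject₁) _ _ V W))

  ∁-full : ∀ n s J V → ∁ (full n s J V) ≡ full n s (∁ J) (∁ V)
  ∁-full zero    s J V = refl
  ∁-full (suc n) s J V rewrite init-map not J | last-map not J =
    trans (map-++ not (replicate (s (fromℕ n)) (last J)) _)
          (cong₂ _++_ (map-replicate not (last J) _) (∁-full n (s ∘ inject₁) (init J) V))

  full-⊤ : ∀ n s → full n s ⊤ ⊤ ≡ ⊤
  full-⊤ zero    s = refl
  full-⊤ (suc n) s rewrite init-replicate n inside | last-replicate n inside =
    trans (cong (⊤ ++_) (full-⊤ n (s ∘ inject₁))) (sym (replicate-++ (s (fromℕ n)) inside))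

  padE-full : ∀ n s V → padE n s V ≡ full n s ⊥ V
  padE-full zero    s V = refl
  padE-full (suc n) s V rewrite init-replicate n outside | last-replicate n outside =
    cong (⊥ ++_) (padE-full n (s ∘ inject₁) V)

  padE-∪ : ∀ n s Z J V → padE n s Z ∪ full n s J V ≡ full n s J (Z ∪ V)
  padE-∪ n s Z J V = begin
    padE n s Z ∪ full n s J V      ≡⟨ cong (_∪ full n s J V) (padE-full n s Z) ⟩
    full n s ⊥ Z ∪ full n s J V    ≡⟨ full-∪ n s ⊥ J Z V ⟩
    full n s (⊥ ∪ J) (Z ∪ V)       ≡⟨ cong (λ K → full n s K (Z ∪ V)) (∪-identityˡ J) ⟩
    full n s J (Z ∪ V)             ∎
    where open ≡-Reasoning

  ∁-padE : ∀ n s Z → ∁ (padE n s Z) ≡ full n s ⊤ (∁ Z)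
  ∁-padE n s Z = begin
    ∁ (padE n s Z)          ≡⟨ cong ∁ (padE-full n s Z) ⟩
    ∁ (full n s ⊥ Z)        ≡⟨ ∁-full n s ⊥ Z ⟩
    full n s (∁ ⊥) (∁ Z)    ≡⟨ cong (λ K → full n s K (∁ Z)) ∁⊥≡⊤ ⟩
    full n s ⊤ (∁ Z)        ∎
    where open ≡-Reasoning

  ∁-padE-∪ : ∀ n s Z J V → ∁ (padE n s Z) ∪ full n s J V ≡ full n s ⊤ (∁ Z ∪ V)
  ∁-padE-∪ n s Z J V = begin
    ∁ (padE n s Z) ∪ full n s J V    ≡⟨ cong (_∪ full n s J V) (∁-padE n s Z) ⟩
    full n s ⊤ (∁ Z) ∪ full n s J V  ≡⟨ full-∪ n s ⊤ J (∁ Z) V ⟩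
    full n s (⊤ ∪ J) (∁ Z ∪ V)       ≡⟨ cong (λ K → full n s K (∁ Z ∪ V)) (∪-zeroˡ J) ⟩
    full n s ⊤ (∁ Z ∪ V)             ∎
    where open ≡-Reasoning

module Blocks {m} {r : Rk m} (M : IsMatroid r) where

  build-isMatroid : ∀ n s X → IsMatroid (build r n s X)
  build-isMatroid zero    s X = M
  build-isMatroid (suc n) s X = freeAddMany-isMatroid (build-isMatroid n _ _) _ (s (fromℕ n))

  -- The corank of `∁ (X i) ∪ V`, which is the rank lost when the block `X i` is traded for its
  -- clones next to `V`.
  deficit : ∀ {n} → (Fin n → Subset m) → Subset m → Fin n → ℕ
  deficit X V i = r ⊤ ∸ r (∁ (X i) ∪ V)

  PairwiseDisjoint : ∀ {n} → (Fin n → Subset m) → Set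
  PairwiseDisjoint X = ∀ i j → i ≢ j → X i ∩ X j ≡ ⊥

  build-full : ∀ n (X : Fin n → Subset m) → PairwiseDisjoint X → ∀ J V →
               build r n (coreSizes r X) X (full n (coreSizes r X) J V) + wsum (deficit X V) J
                 ≡ r (unionF X J ∪ V)
  build-full zero    X dis []  V = trans (+-identityʳ (r V)) (cong r (sym (∪-identityˡ V)))
  build-full (suc n) X dis J V
    rewrite wsum-snoc (deficit X V) J | unionF-snoc X J = step (last J) (init J)
    where
    X′ = X ∘ inject₁
    Xₙ = X (fromℕ n)
    s = coreSizes r X′
    r′ = build r n s X′
    M′ = build-isMatroid n s X′
    Z = padE n s Xₙ

    disₙ : ∀ i → X′ i ∩ Xₙ ≡ ⊥
    disₙ i = dis (inject₁ i) (fromℕ n) (Fin.fromℕ≢inject₁ ∘ sym)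

    IH : ∀ J V → r′ (full n s J V) + wsum (deficit X′ V) J ≡ r (unionF X′ J ∪ V)
    IH = build-full n X′ (λ i j i≢j → dis _ _ (i≢j ∘ Fin.inject₁-injective))

    IH-spanning : ∀ J V → (∀ i → ∁ (X′ i) ∪ V ≡ ⊤) → r′ (full n s J V) ≡ r (unionF X′ J ∪ V)
    IH-spanning J V spans = begin
      r′ (full n s J V)                              ≡⟨ +-identityʳ _ ⟨
      r′ (full n s J V) + 0                          ≡⟨ cong (r′ (full n s J V) +_) (wsum-zero zeros J) ⟨
      r′ (full n s J V) + wsum (deficit X′ V) J      ≡⟨ IH J V ⟩
      r (unionF X′ J ∪ V)                            ∎
      where
      open ≡-Reasoning
      zeros : ∀ i → deficit X′ V i ≡ 0
      zeros i = trans (cong (λ A → r ⊤ ∸ r A) (spans i)) (n∸n≡0 (r ⊤))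

    r′-⊤ : r′ ⊤ ≡ r ⊤
    r′-⊤ = trans (cong r′ (sym (full-⊤ n s)))
      (trans (IH-spanning ⊤ ⊤ (λ i → ∪-zeroʳ _)) (cong r (∪-zeroʳ _)))

    -- The earlier blocks lie inside `∁ Xₙ`, and their deficits vanish there, so all earlier clones
    -- together add nothing to its rank.
    r′-∁ : r′ (full n s ⊤ (∁ Xₙ ∪ V)) ≡ r (∁ Xₙ ∪ V)
    r′-∁ = trans (IH-spanning ⊤ (∁ Xₙ ∪ V) (λ i → disjoint-∁-covers (disₙ i) V)) (cong r (begin
      U ∪ (∁ Xₙ ∪ V)  ≡⟨ boolean (𝐱 ∪ᵗ ∁ᵗ 𝐲 ∪ᵗ 𝐳) (∁ᵗ 𝐲 ∪ᵗ 𝐱 ∪ᵗ 𝐳) U Xₙ V ⟩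
      ∁ Xₙ ∪ (U ∪ V)  ≡⟨ disjoint-∁-absorbs (trans (∩-comm Xₙ U) (unionF-disjoint disₙ ⊤)) V ⟩
      ∁ Xₙ ∪ V        ∎))
      where
      open ≡-Reasoning
      U = unionF X′ ⊤

    -- `last J` and `init J` are generalised to independent variables so that matching on `b`
    -- decides both conditionals.
    step : ∀ b J →
           freeAddMany (conn r Xₙ) r′ Z (replicate (conn r Xₙ) b ++ full n s J V)
             + ((if b then deficit X V (fromℕ n) else 0) + wsum (deficit X′ V) J)
           ≡ r (((if b then Xₙ else ⊥) ∪ unionF X′ J) ∪ V)
    step false J = begin
      freeAddMany k r′ Z (⊥ ++ W) + D   ≡⟨ cong (_+ D) (freeAddMany-++ M′ Z k ⊥ W) ⟩
      r′ W + ∣ ⊥ {k} ∣ ⊓ guts r′ Z W + D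
        ≡⟨ cong (λ c → r′ W + c ⊓ guts r′ Z W + D) (∣⊥∣≡0 k) ⟩
      r′ W + 0 + D                      ≡⟨ cong (_+ D) (+-identityʳ (r′ W)) ⟩
      r′ W + D                          ≡⟨ IH J V ⟩
      r (unionF X′ J ∪ V)               ≡⟨ cong (λ U → r (U ∪ V)) (∪-identityˡ _) ⟨
      r ((⊥ ∪ unionF X′ J) ∪ V)         ∎
      where
      open ≡-Reasoning
      k = conn r Xₙ
      W = full n s J V
      D = wsum (deficit X′ V) J
    -- Adding `q` removes the truncated subtraction, since `d + q` is `r ⊤`.
    step true J = +-cancelʳ-≡ q _ _ (begin
      freeAddMany k r′ Z (⊤ ++ W) + (d + D) + q
        ≡⟨ cong (λ x → x + (d + D) + q) (freeAddMany-++ M′ Z k ⊤ W) ⟩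
      r′ W + ∣ ⊤ {k} ∣ ⊓ g + (d + D) + q
        ≡⟨ cong (λ c → r′ W + c ⊓ g + (d + D) + q) (∣⊤∣≡n k) ⟩
      r′ W + k ⊓ g + (d + D) + q
        ≡⟨ cong (λ c → r′ W + c + (d + D) + q) (m≥n⇒m⊓n≡n g≤k) ⟩
      r′ W + g + (d + D) + q         ≡⟨ rearrange (r′ W) g d D q ⟩
      g + ((d + q) + (r′ W + D))     ≡⟨ cong (g +_) (cong₂ _+_ (m∸n+n≡m (monotone M _ ⊤ ⊆⊤)) (IH J V)) ⟩
      g + (r ⊤ + r (U ∪ V))          ≡⟨ g-eq ⟩
      r (Xₙ ∪ (U ∪ V)) + q           ≡⟨ cong (λ A → r A + q) (sym (∪-assoc Xₙ U V)) ⟩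
      r ((Xₙ ∪ U) ∪ V) + q           ∎)
      where
      open ≡-Reasoning
      k = conn r Xₙ
      W = full n s J V
      U = unionF X′ J
      g = guts r′ Z W
      d = deficit X V (fromℕ n)
      D = wsum (deficit X′ V) J
      q = r (∁ Xₙ ∪ V)
      rearrange : ∀ w g d D q → w + g + (d + D) + q ≡ g + ((d + q) + (w + D))
      rearrange = solve-∀
      move-out : ∀ g t w D → g + (t + (w + D)) ≡ g + (t + w) + D
      move-out = solve-∀
      -- Enlarging `V` by `Xₙ` leaves the earlier deficits alone, because `Xₙ` lies in the
      -- complement of every earlier block.
      IH∪ : r′ (full n s J (Xₙ ∪ V)) + D ≡ r (Xₙ ∪ (U ∪ V))
      IH∪ = begin
        r′ (full n s J (Xₙ ∪ V)) + D
          ≡⟨ cong (r′ (full n s J (Xₙ ∪ V)) +_)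
               (wsum-cong (λ i → cong (λ A → r ⊤ ∸ r A) (disjoint-∁-absorbs (disₙ i) V)) J) ⟨
        r′ (full n s J (Xₙ ∪ V)) + wsum (deficit X′ (Xₙ ∪ V)) J  ≡⟨ IH J (Xₙ ∪ V) ⟩
        r (U ∪ (Xₙ ∪ V))  ≡⟨ cong r (boolean (𝐱 ∪ᵗ 𝐲 ∪ᵗ 𝐳) (𝐲 ∪ᵗ 𝐱 ∪ᵗ 𝐳) U Xₙ V) ⟩
        r (Xₙ ∪ (U ∪ V))  ∎
      g-eq : g + (r ⊤ + r (U ∪ V)) ≡ r (Xₙ ∪ (U ∪ V)) + q
      g-eq = begin
        g + (r ⊤ + r (U ∪ V))                   ≡⟨ cong (λ u → g + (r ⊤ + u)) (IH J V) ⟨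
        g + (r ⊤ + (r′ W + D))                  ≡⟨ move-out g (r ⊤) (r′ W) D ⟩
        g + (r ⊤ + r′ W) + D                    ≡⟨ cong (λ t → g + (t + r′ W) + D) r′-⊤ ⟨
        g + (r′ ⊤ + r′ W) + D                   ≡⟨ cong (_+ D) (guts-eq M′ Z W) ⟩
        r′ (Z ∪ W) + r′ (∁ Z ∪ W) + D
          ≡⟨ cong₂ (λ A B → r′ A + r′ B + D) (padE-∪ n s Xₙ J V) (∁-padE-∪ n s Xₙ J V) ⟩
        r′ (full n s J (Xₙ ∪ V)) + r′ (full n s ⊤ (∁ Xₙ ∪ V)) + D
          ≡⟨ cong (λ c → r′ (full n s J (Xₙ ∪ V)) + c + D) r′-∁ ⟩
        r′ (full n s J (Xₙ ∪ V)) + q + D        ≡⟨ xy∙z≈xz∙y _ q D ⟩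
        r′ (full n s J (Xₙ ∪ V)) + D + q        ≡⟨ cong (_+ q) IH∪ ⟩
        r (Xₙ ∪ (U ∪ V)) + q                    ∎
      -- `g-eq` expresses `g` by ranks of the original matroid. Enlarging `∁ Xₙ ∪ V` by `U` turns
      -- this into the connectivity of `Xₙ` after contracting `U ∪ V`, which is at most `k`.
      g≤k : g ≤ k
      g≤k = ≤-trans (+-cancelʳ-≤ (r ⊤ + r (U ∪ V)) _ _ guts-≤) (guts≤conn M Xₙ (U ∪ V))
        where
        q≤ : q ≤ r (∁ Xₙ ∪ (U ∪ V))
        q≤ = subst (λ A → q ≤ r A) (boolean ((∁ᵗ 𝐱 ∪ᵗ 𝐲) ∪ᵗ 𝐳) (∁ᵗ 𝐱 ∪ᵗ 𝐳 ∪ᵗ 𝐲) Xₙ V U)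
          (rank-∪ˡ M (∁ Xₙ ∪ V) U)
        guts-≤ : g + (r ⊤ + r (U ∪ V)) ≤ guts r Xₙ (U ∪ V) + (r ⊤ + r (U ∪ V))
        guts-≤ = subst₂ _≤_ (sym g-eq) (sym (guts-eq M Xₙ (U ∪ V))) (+-monoʳ-≤ (r (Xₙ ∪ (U ∪ V))) q≤)

-- Cardinalities and singleton index sets

∣replicate∪∣ : ∀ {k} b (S S′ : Subset k) → ∣ S ∣ ≡ ∣ S′ ∣ →
               ∣ replicate k b ∪ S ∣ ≡ ∣ replicate k b ∪ S′ ∣
∣replicate∪∣ true  S S′ eq rewrite ∪-zeroˡ S | ∪-zeroˡ S′ = refl
∣replicate∪∣ false S S′ eq rewrite ∪-identityˡ S | ∪-identityˡ S′ = eq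

∣++∣ : ∀ {a b} (S : Subset a) (U : Subset b) → ∣ S ++ U ∣ ≡ ∣ S ∣ + ∣ U ∣
∣++∣ []          U = refl
∣++∣ (true  ∷ S) U = cong suc (∣++∣ S U)
∣++∣ (false ∷ S) U = ∣++∣ S U

∣replicate∣ : ∀ k b → ∣ replicate k b ∣ ≡ (if b then k else 0)
∣replicate∣ k true  = ∣⊤∣≡n k
∣replicate∣ k false = ∣⊥∣≡0 k

init-⁅fromℕ⁆ : ∀ n → init ⁅ fromℕ n ⁆ ≡ ⊥
init-⁅fromℕ⁆ zero    = refl
init-⁅fromℕ⁆ (suc n) = cong (outside ∷_) (init-⁅fromℕ⁆ n)

last-⁅fromℕ⁆ : ∀ n → last ⁅ fromℕ n ⁆ ≡ inside
last-⁅fromℕ⁆ zero    = refl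
last-⁅fromℕ⁆ (suc n) = last-⁅fromℕ⁆ n

init-⁅inject₁⁆ : ∀ {n} (i : Fin n) → init ⁅ inject₁ i ⁆ ≡ ⁅ i ⁆
init-⁅inject₁⁆ {suc n} Fin.zero    = cong (inside ∷_) (init-replicate n outside)
init-⁅inject₁⁆ (Fin.suc i) = cong (outside ∷_) (init-⁅inject₁⁆ i)

last-⁅inject₁⁆ : ∀ {n} (i : Fin n) → last ⁅ inject₁ i ⁆ ≡ outside
last-⁅inject₁⁆ {suc n} Fin.zero    = last-replicate n outside
last-⁅inject₁⁆ (Fin.suc i) = last-⁅inject₁⁆ i

∩∁-++ : ∀ {a b} {S S′ A : Subset a} {U U′ B : Subset b} →
        (S ++ U) ∩ ∁ (A ++ B) ≡ (S′ ++ U′) ∩ ∁ (A ++ B) → S ∩ ∁ A ≡ S′ ∩ ∁ A × U ∩ ∁ B ≡ U′ ∩ ∁ B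
∩∁-++ {S = S} {S′} {A} {U} {U′} {B} eq = ++-injective (S ∩ ∁ A) (S′ ∩ ∁ A)
  (trans (sym (expand S U)) (trans eq (expand S′ U′)))
  where
  expand : ∀ T V → (T ++ V) ∩ ∁ (A ++ B) ≡ (T ∩ ∁ A) ++ (V ∩ ∁ B)
  expand T V = trans (cong ((T ++ V) ∩_) (map-++ not A B)) (zipWith-++ _∧_ T V (∁ A) (∁ B))

∩∁⊥-injective : ∀ {p} {A B : Subset p} → A ∩ ∁ ⊥ ≡ B ∩ ∁ ⊥ → A ≡ B
∩∁⊥-injective {A = A} {B} eq = trans (sym (id A)) (trans eq (id B))
  where
  id : ∀ C → C ∩ ∁ ⊥ ≡ C
  id C = trans (cong (C ∩_) ∁⊥≡⊤) (∩-identityʳ C)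

-- Symmetry of the construction within a block

module _ {m : ℕ} where

  -- Two subsets of the ground set of Mₙ agree on E and meet every Yᵢ in equally many elements.
  data SameCounts : ∀ n (s : Fin n → ℕ) (W W′ : Subset (G {m} n s)) → Set where
    same  : ∀ {s V} → SameCounts zero s V V
    block : ∀ {n s} (S S′ : Subset (s (fromℕ n))) {U U′} → ∣ S ∣ ≡ ∣ S′ ∣ →
            SameCounts n (s ∘ inject₁) U U′ → SameCounts (suc n) s (S ++ U) (S′ ++ U′)

  sameCounts-refl : ∀ n s W → SameCounts n s W W
  sameCounts-refl zero    s W = same
  sameCounts-refl (suc n) s W with splitAt (s (fromℕ n)) W
  ... | S , U , refl = block S S refl (sameCounts-refl n _ U)

  -- A whole block swallows the trace on it, and an empty one leaves the trace alone. Both `Z` and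
  -- `∁ Z` are of the form `full`, so the induction for `build-sameCounts` reaches the two ranks
  -- inside `guts`.
  sameCounts-full-∪ : ∀ n s J V {W W′} → SameCounts n s W W′ →
                      SameCounts n s (full n s J V ∪ W) (full n s J V ∪ W′)
  sameCounts-full-∪ zero    s J V same = same
  sameCounts-full-∪ (suc n) s J V (block S S′ {U} {U′} eq rest) =
    subst₂ (SameCounts (suc n) s)
      (sym (∪-++ (replicate _ (last J)) S _ U)) (sym (∪-++ (replicate _ (last J)) S′ _ U′))
      (block _ _ (∣replicate∪∣ (last J) S S′ eq) (sameCounts-full-∪ n _ (init J) V rest))

  build-sameCounts : ∀ {r : Rk m} → IsMatroid r → ∀ n s X {W W′} → SameCounts n s W W′ →
                     build r n s X W ≡ build r n s X W′
  build-sameCounts M zero    s X same = refl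
  build-sameCounts {r} M (suc n) s X (block S S′ {U} {U′} eq rest) = begin
    freeAddMany k r′ Z (S ++ U)      ≡⟨ freeAddMany-++ M′ Z k S U ⟩
    r′ U + ∣ S ∣ ⊓ guts r′ Z U       ≡⟨ cong₂ _+_ U-rank (cong₂ _⊓_ eq guts-same) ⟩
    r′ U′ + ∣ S′ ∣ ⊓ guts r′ Z U′    ≡⟨ freeAddMany-++ M′ Z k S′ U′ ⟨
    freeAddMany k r′ Z (S′ ++ U′)    ∎
    where
    open ≡-Reasoning
    k = s (fromℕ n)
    s′ = s ∘ inject₁
    X′ = X ∘ inject₁
    r′ = build r n s′ X′
    M′ = Blocks.build-isMatroid M n s′ X′
    Z = padE n s′ (X (fromℕ n))
    U-rank : r′ U ≡ r′ U′
    U-rank = build-sameCounts M n s′ X′ rest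
    ∪-rank : ∀ A J V → A ≡ full n s′ J V → r′ (A ∪ U) ≡ r′ (A ∪ U′)
    ∪-rank A J V refl = build-sameCounts M n s′ X′ (sameCounts-full-∪ n s′ J V rest)
    guts-same : guts r′ Z U ≡ guts r′ Z U′
    guts-same = +-cancelʳ-≡ (r′ ⊤ + r′ U) _ _ (begin
      guts r′ Z U + (r′ ⊤ + r′ U)      ≡⟨ guts-eq M′ Z U ⟩
      r′ (Z ∪ U) + r′ (∁ Z ∪ U)
        ≡⟨ cong₂ _+_ (∪-rank Z _ _ (padE-full n s′ _)) (∪-rank (∁ Z) _ _ (∁-padE n s′ _)) ⟩
      r′ (Z ∪ U′) + r′ (∁ Z ∪ U′)      ≡⟨ guts-eq M′ Z U′ ⟨
      guts r′ Z U′ + (r′ ⊤ + r′ U′)    ≡⟨ cong (λ x → guts r′ Z U′ + (r′ ⊤ + x)) U-rank ⟨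
      guts r′ Z U′ + (r′ ⊤ + r′ U)     ∎)

  -- `embedY` is blocked on `splitAt`; injectivity of `_++_` identifies the parts it returns with
  -- the given ones.
  embedY-++ : ∀ n s (S : Subset (s (fromℕ n))) U →
              embedY {m} (suc n) s (S ++ U) ≡ S ++ embedY n (s ∘ inject₁) U
  embedY-++ n s S U with splitAt (s (fromℕ n)) (S ++ U)
  ... | S′ , U′ , eq with refl ← ++-injectiveˡ S S′ eq | refl ← ++-injectiveʳ S S′ eq = refl

  embedY-ySet : ∀ n s J → embedY {m} n s (ySet {m} n s J) ≡ full n s J ⊥
  embedY-ySet zero    s J = refl
  embedY-ySet (suc n) s J =
    trans (embedY-++ n s _ _) (cong (replicate _ (last J) ++_) (embedY-ySet n _ (init J)))

  embedY-⊤ : ∀ n s → embedY {m} n s ⊤ ≡ full n s ⊤ ⊥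
  embedY-⊤ zero    s = refl
  embedY-⊤ (suc n) s rewrite init-replicate n inside | last-replicate n inside =
    trans (cong (embedY (suc n) s) (replicate-++ (s (fromℕ n)) inside))
          (trans (embedY-++ n s _ _) (cong (⊤ ++_) (embedY-⊤ n _)))

  ySet-∪ : ∀ n s J K → ySet {m} n s (J ∪ K) ≡ ySet {m} n s J ∪ ySet {m} n s K
  ySet-∪ zero    s J K = refl
  ySet-∪ (suc n) s J K rewrite init-zipWith _∨_ J K | last-zipWith _∨_ J K = sym
    (trans (∪-++ (replicate (s (fromℕ n)) (last J)) (replicate _ (last K)) _ _)
           (cong₂ _++_ (zipWith-replicate _∨_ (last J) (last K)) (sym (ySet-∪ n _ (init J) (init K)))))

  ∁-ySet : ∀ n s J → ∁ (ySet {m} n s J) ≡ ySet {m} n s (∁ J)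
  ∁-ySet zero    s J = refl
  ∁-ySet (suc n) s J rewrite init-map not J | last-map not J =
    trans (map-++ not (replicate (s (fromℕ n)) (last J)) _)
          (cong₂ _++_ (map-replicate not (last J) _) (∁-ySet n _ (init J)))

  ySet-⊤ : ∀ n s → ySet {m} n s ⊤ ≡ ⊤
  ySet-⊤ zero    s = refl
  ySet-⊤ (suc n) s rewrite init-replicate n inside | last-replicate n inside =
    trans (cong (⊤ ++_) (ySet-⊤ n _)) (sym (replicate-++ (s (fromℕ n)) inside))

  ySet-⊥ : ∀ n s → ySet {m} n s ⊥ ≡ ⊥
  ySet-⊥ zero    s = refl
  ySet-⊥ (suc n) s rewrite init-replicate n outside | last-replicate n outside =
    trans (cong (⊥ ++_) (ySet-⊥ n _)) (sym (replicate-++ (s (fromℕ n)) outside))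

  ∣ySet∣ : ∀ n s J → ∣ ySet {m} n s J ∣ ≡ wsum s J
  ∣ySet∣ zero    s [] = refl
  ∣ySet∣ (suc n) s J = begin
    ∣ B ++ Y ∣      ≡⟨ ∣++∣ B Y ⟩
    ∣ B ∣ + ∣ Y ∣   ≡⟨ cong₂ _+_ (∣replicate∣ (s (fromℕ n)) (last J)) (∣ySet∣ n (s ∘ inject₁) (init J)) ⟩
    (if last J then s (fromℕ n) else 0) + wsum (s ∘ inject₁) (init J)  ≡⟨ wsum-snoc s J ⟨
    wsum s J        ∎
    where
    open ≡-Reasoning
    B = replicate (s (fromℕ n)) (last J)
    Y = ySet {m} n (s ∘ inject₁) (init J)

  ∣full∣ : ∀ n s J (V : Subset m) → ∣ full n s J V ∣ ≡ ∣ ySet {m} n s J ∣ + ∣ V ∣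
  ∣full∣ zero    s [] V = refl
  ∣full∣ (suc n) s J V = begin
    ∣ B ++ full n (s ∘ inject₁) (init J) V ∣     ≡⟨ ∣++∣ B _ ⟩
    ∣ B ∣ + ∣ full n (s ∘ inject₁) (init J) V ∣            ≡⟨ cong (∣ B ∣ +_) (∣full∣ n (s ∘ inject₁) (init J) V) ⟩
    ∣ B ∣ + (∣ Y ∣ + ∣ V ∣)                    ≡⟨ +-assoc ∣ B ∣ _ _ ⟨
    ∣ B ∣ + ∣ Y ∣ + ∣ V ∣                      ≡⟨ cong (_+ ∣ V ∣) (∣++∣ B Y) ⟨
    ∣ B ++ Y ∣ + ∣ V ∣                         ∎
    where
    open ≡-Reasoning
    B = replicate (s (fromℕ n)) (last J)
    Y = ySet {m} n (s ∘ inject₁) (init J)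

  -- Equal total sizes are enough: all blocks other than `i` have equal traces, so their sizes
  -- cancel and the counts in block `i` agree.
  sameCounts-embedY : ∀ n s i {W W′} → ∣ W ∣ ≡ ∣ W′ ∣ →
    W ∩ ∁ (ySet {m} n s ⁅ i ⁆) ≡ W′ ∩ ∁ (ySet {m} n s ⁅ i ⁆) →
    SameCounts n s (embedY n s W) (embedY n s W′)
  sameCounts-embedY (suc n) s i {W} {W′} card away
    with S , U , refl ← splitAt (s (fromℕ n)) W
       | S′ , U′ , refl ← splitAt (s (fromℕ n)) W′
    rewrite ∣++∣ S U | ∣++∣ S′ U′ with view i
  ... | ‵fromℕ rewrite last-⁅fromℕ⁆ n | init-⁅fromℕ⁆ n | ySet-⊥ n (s ∘ inject₁)
    with refl ← ∩∁⊥-injective (proj₂ (∩∁-++ {S = S} {S′} {⊤} {U} {U′} {⊥} away)) =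
    block S S′ (+-cancelʳ-≡ ∣ U ∣ _ _ card) (sameCounts-refl n _ _)
  ... | ‵inject₁ j rewrite last-⁅inject₁⁆ j | init-⁅inject₁⁆ j
    with S-eq , U-eq ← ∩∁-++ {S = S} {S′} {⊥} {U} {U′} {ySet {m} n (s ∘ inject₁) ⁅ j ⁆} away
    with refl ← ∩∁⊥-injective S-eq =
    block S S refl (sameCounts-embedY n _ j (+-cancelˡ-≡ ∣ S ∣ _ _ card) U-eq)

-- Permutations that move only elements of one block

∣tabulate∣ : ∀ {p} (f : Fin p → Bool) → ∣ tabulate f ∣ ≡ ∑ (λ e → if f e then 1 else 0)
∣tabulate∣ {zero}  f = refl
∣tabulate∣ {suc p} f with f Fin.zero
... | true  = cong suc (∣tabulate∣ (f ∘ Fin.suc))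
... | false = ∣tabulate∣ (f ∘ Fin.suc)

∣image∣ : ∀ {p} (σ : Permutation′ p) W → ∣ image σ W ∣ ≡ ∣ W ∣
∣image∣ σ W = begin
  ∣ image σ W ∣                                        ≡⟨ ∣tabulate∣ (λ e → lookup W (σ ⟨$⟩ˡ e)) ⟩
  -- `image` reads `W` at the inverse permutation, hence `flip`.
  ∑ (λ e → if lookup W (σ ⟨$⟩ˡ e) then 1 else 0)       ≡⟨ sum-permute _ (flip σ) ⟨
  ∑ (λ e → if lookup W e then 1 else 0)                ≡⟨ ∣tabulate∣ (lookup W) ⟨
  ∣ tabulate (lookup W) ∣                              ≡⟨ cong ∣_∣ (tabulate∘lookup W) ⟩
  ∣ W ∣                                                ∎
  where open ≡-Reasoning

image-away : ∀ {p} (σ : Permutation′ p) {A} → (∀ e → e ∉ A → σ ⟨$⟩ʳ e ≡ e) →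
             ∀ W → image σ W ∩ ∁ A ≡ W ∩ ∁ A
image-away σ {A} fixes W = begin
  image σ W ∩ ∁ A                       ≡⟨ tabulate∘lookup _ ⟨
  tabulate (lookup (image σ W ∩ ∁ A))   ≡⟨ tabulate-cong pointwise ⟩
  tabulate (lookup (W ∩ ∁ A))           ≡⟨ tabulate∘lookup _ ⟩
  W ∩ ∁ A                               ∎
  where
  open ≡-Reasoning
  image-fixed : ∀ e → e ∉ A → lookup (image σ W) e ≡ lookup W e
  image-fixed e e∉A = trans (lookup∘tabulate _ e)
    (cong (lookup W) (trans (cong (σ ⟨$⟩ˡ_) (sym (fixes e e∉A))) (inverseˡ σ)))
  pointwise : ∀ e → lookup (image σ W ∩ ∁ A) e ≡ lookup (W ∩ ∁ A) e
  pointwise e rewrite lookup-zipWith _∧_ e (image σ W) (∁ A) | lookup-zipWith _∧_ e W (∁ A)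
    with e ∈? A
  ... | no e∉A = cong (_∧ lookup (∁ A) e) (image-fixed e e∉A)
  ... | yes e∈A rewrite lookup-map e not A | []=⇒lookup e∈A =
    trans (Bool.∧-zeroʳ _) (sym (Bool.∧-zeroʳ _))

coreBlock-clones : ∀ {m n} {r : Rk m} → IsMatroid r → ∀ (X : Fin n → Subset m) i →
                   Clones (coreRk r X) (coreBlock r X i)
coreBlock-clones {n = n} {r} M X i σ fixes W =
  build-sameCounts M n (coreSizes r X) X
    (sameCounts-embedY n (coreSizes r X) i (∣image∣ σ W) (image-away σ fixes W))

-- Sums and unions over an index set

wsum-⊥ : ∀ {n} (w : Fin n → ℕ) → wsum w ⊥ ≡ 0
wsum-⊥ {zero}  w = refl
wsum-⊥ {suc n} w = wsum-⊥ (w ∘ Fin.suc)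

wsum-⁅⁆ : ∀ {n} (w : Fin n → ℕ) i → wsum w ⁅ i ⁆ ≡ w i
wsum-⁅⁆ w Fin.zero    = trans (cong (w Fin.zero +_) (wsum-⊥ (w ∘ Fin.suc))) (+-identityʳ _)
wsum-⁅⁆ w (Fin.suc i) = wsum-⁅⁆ (w ∘ Fin.suc) i

wsum-⊤ : ∀ {n} (w : Fin n → ℕ) → wsum w ⊤ ≡ sum (tabulate w)
wsum-⊤ {zero}  w = refl
wsum-⊤ {suc n} w = cong (w Fin.zero +_) (wsum-⊤ (w ∘ Fin.suc))

wsum-modular : ∀ {n} (w : Fin n → ℕ) J K → wsum w (J ∪ K) + wsum w (J ∩ K) ≡ wsum w J + wsum w K
wsum-modular w []      []      = refl
wsum-modular w (b ∷ J) (c ∷ K) = begin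
  (pick (b ∨ c) + wsum w′ (J ∪ K)) + (pick (b ∧ c) + wsum w′ (J ∩ K))
    ≡⟨ interchange (pick (b ∨ c)) _ _ _ ⟩
  (pick (b ∨ c) + pick (b ∧ c)) + (wsum w′ (J ∪ K) + wsum w′ (J ∩ K))
    ≡⟨ cong₂ _+_ (pick-modular b c) (wsum-modular w′ J K) ⟩
  (pick b + pick c) + (wsum w′ J + wsum w′ K)
    ≡⟨ interchange (pick b) _ _ _ ⟩
  (pick b + wsum w′ J) + (pick c + wsum w′ K) ∎
  where
  open ≡-Reasoning
  w′ = w ∘ Fin.suc
  pick : Bool → ℕ
  pick b = if b then w Fin.zero else 0
  pick-modular : ∀ b c → pick (b ∨ c) + pick (b ∧ c) ≡ pick b + pick c
  pick-modular true  c = refl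
  pick-modular false c = +-identityʳ (pick c)

wsum-disjoint : ∀ {n} (w : Fin n → ℕ) {J K} → Disjoint J K → wsum w (J ∪ K) ≡ wsum w J + wsum w K
wsum-disjoint w {J} {K} dis = begin
  wsum w (J ∪ K)                    ≡⟨ +-identityʳ _ ⟨
  wsum w (J ∪ K) + 0                ≡⟨ cong (wsum w (J ∪ K) +_) (trans (cong (wsum w) dis) (wsum-⊥ w)) ⟨
  wsum w (J ∪ K) + wsum w (J ∩ K)   ≡⟨ wsum-modular w J K ⟩
  wsum w J + wsum w K               ∎
  where open ≡-Reasoning

wsum-∁ : ∀ {n} (w : Fin n → ℕ) J → wsum w ⊤ ≡ wsum w J + wsum w (∁ J)
wsum-∁ w J = trans (cong (wsum w) (sym (p∪∁p≡⊤ J))) (wsum-disjoint w (∩-inverseʳ J))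

∣∣≡wsum : ∀ {p} (A : Subset p) → ∣ A ∣ ≡ wsum (λ _ → 1) A
∣∣≡wsum []          = refl
∣∣≡wsum (true  ∷ A) = cong suc (∣∣≡wsum A)
∣∣≡wsum (false ∷ A) = ∣∣≡wsum A

∣∪∣-disjoint : ∀ {p} {A B : Subset p} → Disjoint A B → ∣ A ∪ B ∣ ≡ ∣ A ∣ + ∣ B ∣
∣∪∣-disjoint {A = A} {B} dis rewrite ∣∣≡wsum (A ∪ B) | ∣∣≡wsum A | ∣∣≡wsum B = wsum-disjoint _ dis

unionF-⊥ : ∀ {n p} (W : Fin n → Subset p) → unionF W ⊥ ≡ ⊥
unionF-⊥ {zero}  W = refl
unionF-⊥ {suc n} W = trans (∪-identityˡ _) (unionF-⊥ (W ∘ Fin.suc))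

unionF-⁅⁆ : ∀ {n p} (W : Fin n → Subset p) i → unionF W ⁅ i ⁆ ≡ W i
unionF-⁅⁆ W Fin.zero    = trans (cong (W Fin.zero ∪_) (unionF-⊥ (W ∘ Fin.suc))) (∪-identityʳ _)
unionF-⁅⁆ W (Fin.suc i) = trans (∪-identityˡ _) (unionF-⁅⁆ (W ∘ Fin.suc) i)

unionF-∪ : ∀ {n p} (W : Fin n → Subset p) J K → unionF W (J ∪ K) ≡ unionF W J ∪ unionF W K
unionF-∪ W []      []      = sym (∪-identityˡ ⊥)
unionF-∪ W (b ∷ J) (c ∷ K) rewrite unionF-∪ (W ∘ Fin.suc) J K = cases b c
  where
  A = unionF (W ∘ Fin.suc) J
  B = unionF (W ∘ Fin.suc) K
  first : Bool → Subset _
  first b = if b then W Fin.zero else ⊥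
  cases : ∀ b c → first (b ∨ c) ∪ (A ∪ B) ≡ (first b ∪ A) ∪ (first c ∪ B)
  cases true  true  = boolean (𝐱 ∪ᵗ 𝐲 ∪ᵗ 𝐳) ((𝐱 ∪ᵗ 𝐲) ∪ᵗ (𝐱 ∪ᵗ 𝐳)) (W Fin.zero) A B
  cases true  false rewrite ∪-identityˡ B = sym (∪-assoc (W Fin.zero) A B)
  cases false true  rewrite ∪-identityˡ A =
    boolean (𝐱 ∪ᵗ 𝐲 ∪ᵗ 𝐳) (𝐲 ∪ᵗ 𝐱 ∪ᵗ 𝐳) (W Fin.zero) A B
  cases false false rewrite ∪-identityˡ A | ∪-identityˡ B = ∪-identityˡ (A ∪ B)

-- With `f` equal to `ySet`, which sends singletons to core blocks, this identifies a union of core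
-- blocks with the `ySet` of its index set.
unionF-homo : ∀ {p q} (f : Subset p → Subset q) → f ⊥ ≡ ⊥ → (∀ A B → f (A ∪ B) ≡ f A ∪ f B) →
              ∀ {n} (W : Fin n → Subset p) J → unionF (f ∘ W) J ≡ f (unionF W J)
unionF-homo f f-⊥ f-∪ W []      = sym f-⊥
unionF-homo f f-⊥ f-∪ W (b ∷ J) =
  trans (cong₂ _∪_ (first b) (unionF-homo f f-⊥ f-∪ (W ∘ Fin.suc) J)) (sym (f-∪ _ _))
  where
  first : ∀ b → (if b then f (W Fin.zero) else ⊥) ≡ f (if b then W Fin.zero else ⊥)
  first true  = refl
  first false = sym f-⊥

unionF-singletons : ∀ {n} (J : Subset n) → unionF ⁅_⁆ J ≡ J
unionF-singletons []      = refl
unionF-singletons (b ∷ J)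
  rewrite unionF-homo (outside ∷_) refl (λ _ _ → refl) ⁅_⁆ J | unionF-singletons J = first b
  where
  first : ∀ b → (if b then ⁅ Fin.zero ⁆ else ⊥) ∪ (outside ∷ J) ≡ b ∷ J
  first true  = cong (inside ∷_) (∪-identityˡ J)
  first false = cong (outside ∷_) (∪-identityˡ J)

∈-unionF⁻ : ∀ {n p} (W : Fin n → Subset p) J {e} → e ∈ unionF W J → ∃ λ i → i ∈ J × e ∈ W i
∈-unionF⁻ W []      e∈ = contradiction e∈ ∉⊥
∈-unionF⁻ W (b ∷ J) e∈ with x∈p∪q⁻ (if b then W Fin.zero else ⊥) _ e∈
∈-unionF⁻ W (true  ∷ J) _ | inj₁ e∈W = Fin.zero , here , e∈W
∈-unionF⁻ W (false ∷ J) _ | inj₁ e∈⊥ = contradiction e∈⊥ ∉⊥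
∈-unionF⁻ W (b     ∷ J) _ | inj₂ e∈U with i , i∈J , e∈W ← ∈-unionF⁻ (W ∘ Fin.suc) J e∈U =
  Fin.suc i , there i∈J , e∈W

∈-unionF-⊤ : ∀ {n p} (W : Fin n → Subset p) i {e} → e ∈ W i → e ∈ unionF W ⊤
∈-unionF-⊤ W Fin.zero    e∈ = x∈p∪q⁺ (inj₁ e∈)
∈-unionF-⊤ W (Fin.suc i) e∈ = x∈p∪q⁺ (inj₂ (∈-unionF-⊤ (W ∘ Fin.suc) i e∈))

-- Complements and partitions

∁-unique : ∀ {p} {A B : Subset p} → A ∪ B ≡ ⊤ → A ∩ B ≡ ⊥ → ∁ A ≡ B
∁-unique {A = A} {B} A∪B≡⊤ A∩B≡⊥ = begin
  ∁ A                    ≡⟨ ∩-identityʳ (∁ A) ⟨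
  ∁ A ∩ ⊤                ≡⟨ cong (∁ A ∩_) A∪B≡⊤ ⟨
  ∁ A ∩ (A ∪ B)          ≡⟨ boolean (∁ᵗ 𝐱 ∩ᵗ (𝐱 ∪ᵗ 𝐲)) (∁ᵗ 𝐱 ∩ᵗ 𝐲) A B B ⟩
  ∁ A ∩ B                ≡⟨ ∪-identityˡ _ ⟨
  ⊥ ∪ (∁ A ∩ B)          ≡⟨ cong (_∪ (∁ A ∩ B)) A∩B≡⊥ ⟨
  (A ∩ B) ∪ (∁ A ∩ B)    ≡⟨ boolean ((𝐱 ∩ᵗ 𝐲) ∪ᵗ (∁ᵗ 𝐱 ∩ᵗ 𝐲)) 𝐲 A B B ⟩
  B                      ∎
  where open ≡-Reasoning

module Partition {m n} {X : Fin n → Subset m} (part : IsPartition X) where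
  open IsPartition part

  unionF-separates : ∀ {J K} → Disjoint J K → Disjoint (unionF X J) (unionF X K)
  unionF-separates {J} {K} J∩K≡⊥ = Empty-unique λ (e , e∈) →
    let e∈J , e∈K = x∈p∩q⁻ (unionF X J) (unionF X K) e∈
        i , i∈J , e∈Xi = ∈-unionF⁻ X J e∈J
        j , j∈K , e∈Xj = ∈-unionF⁻ X K e∈K
        i≢j = λ i≡j → ∉⊥ (subst (i ∈_) J∩K≡⊥ (x∈p∩q⁺ (i∈J , subst (_∈ K) (sym i≡j) j∈K)))
    in ∉⊥ (subst (e ∈_) (disjoint i j i≢j) (x∈p∩q⁺ (e∈Xi , e∈Xj)))

  unionF-⊤ : unionF X ⊤ ≡ ⊤
  unionF-⊤ = ⊆-antisym ⊆⊤ λ {e} _ → let i , e∈Xi = covers e in ∈-unionF-⊤ X i e∈Xi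

  -- The blocks are disjoint and cover the ground set, so the rank formula at the index set `∁ J`
  -- also handles the complement of a union of blocks.
  ∁-unionF : ∀ J → ∁ (unionF X J) ≡ unionF X (∁ J)
  ∁-unionF J = ∁-unique
    (trans (sym (unionF-∪ X J (∁ J))) (trans (cong (unionF X) (p∪∁p≡⊤ J)) unionF-⊤))
    (unionF-separates (∩-inverseʳ J))

-- Comparison of M with its core

dual-eq : ∀ {p} (r : Rk p) A → r ⊤ ≤ ∣ A ∣ + r (∁ A) → dual r A + r ⊤ ≡ ∣ A ∣ + r (∁ A)
dual-eq r A = m∸n+n≡m

-- Additive corrections shift minuend and subtrahend equally, and even truncated subtraction ignores
-- such a shift. One form serves λ, ⊓ and ⊓*; the `q` are zero for the first two.
∸-shift : ∀ a₁ a₂ a₃ b₁ b₂ b₃ {p₁ p₂ p₃ q₁ q₂ q₃} →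
          a₁ + p₁ ≡ b₁ + q₁ → a₂ + p₂ ≡ b₂ + q₂ → a₃ + p₃ ≡ b₃ + q₃ → p₃ ≡ p₁ + p₂ → q₃ ≡ q₁ + q₂ →
          a₁ + a₂ ∸ a₃ ≡ b₁ + b₂ ∸ b₃
∸-shift a₁ a₂ a₃ b₁ b₂ b₃ {p₁} {p₂} {_} {q₁} {q₂} eq₁ eq₂ eq₃ refl refl = begin
  a₁ + a₂ ∸ a₃                             ≡⟨ [m+n]∸[m+o]≡n∸o (p₁ + p₂) (a₁ + a₂) a₃ ⟨
  (p₁ + p₂ + (a₁ + a₂)) ∸ (p₁ + p₂ + a₃)   ≡⟨ cong₂ _∸_ (collect p₁ p₂ a₁ a₂) (+-comm (p₁ + p₂) a₃) ⟩
  (a₁ + p₁ + (a₂ + p₂)) ∸ (a₃ + (p₁ + p₂)) ≡⟨ cong₂ _∸_ (cong₂ _+_ eq₁ eq₂) eq₃ ⟩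
  (b₁ + q₁ + (b₂ + q₂)) ∸ (b₃ + (q₁ + q₂)) ≡⟨ cong₂ _∸_ (collect q₁ q₂ b₁ b₂) (+-comm (q₁ + q₂) b₃) ⟨
  (q₁ + q₂ + (b₁ + b₂)) ∸ (q₁ + q₂ + b₃)   ≡⟨ [m+n]∸[m+o]≡n∸o (q₁ + q₂) (b₁ + b₂) b₃ ⟩
  b₁ + b₂ ∸ b₃                             ∎
  where
  open ≡-Reasoning
  collect : ∀ p q a b → p + q + (a + b) ≡ a + p + (b + q)
  collect = solve-∀

module Core {m n} {r : Rk m} (M : IsMatroid r) {X : Fin n → Subset m} (part : IsPartition X) where
  open Partition part
  open Blocks M

  s = coreSizes r X
  r̂ = coreRk r X

  X[_] : Subset n → Subset m
  X[_] = unionF X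

  Y[_] : Subset n → Subset (coreSize r X)
  Y[ J ] = ySet {m} n s J

  -- The nullity of `X i` in the dual matroid, which is the deficit at the empty set.
  d : Fin n → ℕ
  d i = r ⊤ ∸ r (∁ (X i))

  d-eq : ∀ i → d i + r (∁ (X i)) ≡ r ⊤
  d-eq i = m∸n+n≡m (monotone M _ ⊤ ⊆⊤)

  unionF-coreBlock : ∀ J → unionF (coreBlock r X) J ≡ Y[ J ]
  unionF-coreBlock J = trans (unionF-homo Y[_] (ySet-⊥ n s) (ySet-∪ n s) ⁅_⁆ J)
                             (cong Y[_] (unionF-singletons J))

  r̂-eq : ∀ J → r̂ Y[ J ] + wsum d J ≡ r X[ J ]
  r̂-eq J = begin
    r̂ Y[ J ] + wsum d J
      ≡⟨ cong₂ _+_ (cong (build r n s X) (embedY-ySet n s J))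
           (wsum-cong (λ i → cong (λ A → r ⊤ ∸ r A) (sym (∪-identityʳ (∁ (X i))))) J) ⟩
    build r n s X (full n s J ⊥) + wsum (deficit X ⊥) J
      ≡⟨ build-full n X (IsPartition.disjoint part) J ⊥ ⟩
    r (X[ J ] ∪ ⊥)  ≡⟨ cong r (∪-identityʳ _) ⟩
    r X[ J ]        ∎
    where open ≡-Reasoning

  r̂-∁ : ∀ J → r̂ (∁ Y[ J ]) + wsum d (∁ J) ≡ r (∁ X[ J ])
  r̂-∁ J = begin
    r̂ (∁ Y[ J ]) + wsum d (∁ J)  ≡⟨ cong (λ A → r̂ A + wsum d (∁ J)) (∁-ySet n s J) ⟩
    r̂ Y[ ∁ J ] + wsum d (∁ J)    ≡⟨ r̂-eq (∁ J) ⟩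
    r X[ ∁ J ]                   ≡⟨ cong r (∁-unionF J) ⟨
    r (∁ X[ J ])                 ∎
    where open ≡-Reasoning

  r̂-⊤ : r̂ ⊤ + wsum d ⊤ ≡ r ⊤
  r̂-⊤ = trans (cong (λ A → r̂ A + wsum d ⊤) (sym (ySet-⊤ n s))) (trans (r̂-eq ⊤) (cong r unionF-⊤))

  conn-core : ∀ J → conn r X[ J ] ≡ conn r̂ Y[ J ]
  conn-core J = sym (∸-shift (r̂ Y[ J ]) (r̂ (∁ Y[ J ])) (r̂ ⊤) (r X[ J ]) (r (∁ X[ J ])) (r ⊤)
    (trans (r̂-eq J) (sym (+-identityʳ _))) (trans (r̂-∁ J) (sym (+-identityʳ _)))
    (trans r̂-⊤ (sym (+-identityʳ _))) (wsum-∁ d J) refl)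

  lc-core : ∀ {J K} → Disjoint J K → lc r X[ J ] X[ K ] ≡ lc r̂ Y[ J ] Y[ K ]
  lc-core {J} {K} dis = sym (∸-shift
    (r̂ Y[ J ]) (r̂ Y[ K ]) (r̂ (Y[ J ] ∪ Y[ K ])) (r X[ J ]) (r X[ K ]) (r (X[ J ] ∪ X[ K ]))
    (trans (r̂-eq J) (sym (+-identityʳ _))) (trans (r̂-eq K) (sym (+-identityʳ _)))
    (trans r̂-∪ (sym (+-identityʳ _))) (wsum-disjoint d dis) refl)
    where
    r̂-∪ : r̂ (Y[ J ] ∪ Y[ K ]) + wsum d (J ∪ K) ≡ r (X[ J ] ∪ X[ K ])
    r̂-∪ = trans (cong (λ A → r̂ A + wsum d (J ∪ K)) (sym (ySet-∪ n s J K)))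
                (trans (r̂-eq (J ∪ K)) (cong r (unionF-∪ X J K)))

  -- This makes the subtraction in `dual r̂` exact. It is proved in `build`, whose matroid axioms
  -- are at hand, and carried back along `embedY`.
  r̂-spanned : ∀ J → r̂ ⊤ ≤ ∣ Y[ J ] ∣ + r̂ (∁ Y[ J ])
  r̂-spanned J = begin
    r̂ ⊤                                                         ≡⟨ cong b (embedY-⊤ n s) ⟩
    b (full n s ⊤ ⊥)                                            ≡⟨ cong b cover ⟨
    b (full n s J ⊥ ∪ full n s (∁ J) ⊥)                         ≤⟨ rank-∪-≤ (build-isMatroid n s X) _ _ ⟩
    ∣ full n s J ⊥ ∣ + b (full n s (∁ J) ⊥)                     ≡⟨ cong₂ _+_ size rest ⟩
    ∣ Y[ J ] ∣ + r̂ (∁ Y[ J ])                                   ∎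
    where
    open ≤-Reasoning
    b = build r n s X
    cover : full n s J ⊥ ∪ full n s (∁ J) ⊥ ≡ full n s ⊤ ⊥
    cover = trans (full-∪ n s J (∁ J) ⊥ ⊥) (cong₂ (full n s) (p∪∁p≡⊤ J) (∪-identityˡ ⊥))
    size : ∣ full n s J ⊥ ∣ ≡ ∣ Y[ J ] ∣
    size = trans (∣full∣ n s J ⊥) (trans (cong (∣ Y[ J ] ∣ +_) (∣⊥∣≡0 m)) (+-identityʳ _))
    rest : b (full n s (∁ J) ⊥) ≡ r̂ (∁ Y[ J ])
    rest = cong b (sym (trans (cong (embedY n s) (∁-ySet n s J)) (embedY-ySet n s (∁ J))))

  -- The corrections of the ground set and of the complement differ by `wsum d J`. The cardinalities
  -- enter because the dual rank counts elements and `X[ J ]` and `Y[ J ]` differ in size.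
  dual-core : ∀ J → dual r̂ Y[ J ] + ∣ X[ J ] ∣ ≡ dual r X[ J ] + (∣ Y[ J ] ∣ + wsum d J)
  dual-core J = +-cancelʳ-≡ (r ⊤) _ _ (begin
    dual r̂ Y[ J ] + x + r ⊤
      ≡⟨ cong (dual r̂ Y[ J ] + x +_) (trans (sym r̂-⊤) (cong (r̂ ⊤ +_) (wsum-∁ d J))) ⟩
    dual r̂ Y[ J ] + x + (r̂ ⊤ + (D + D′))  ≡⟨ pull (dual r̂ Y[ J ]) x (r̂ ⊤) D D′ ⟩
    dual r̂ Y[ J ] + r̂ ⊤ + (x + D + D′)
      ≡⟨ cong (_+ (x + D + D′)) (dual-eq r̂ Y[ J ] (r̂-spanned J)) ⟩
    y + r̂ (∁ Y[ J ]) + (x + D + D′)       ≡⟨ pull′ y (r̂ (∁ Y[ J ])) x D D′ ⟩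
    x + (r̂ (∁ Y[ J ]) + D′) + (y + D)     ≡⟨ cong (λ k → x + k + (y + D)) (r̂-∁ J) ⟩
    x + r (∁ X[ J ]) + (y + D)
      ≡⟨ cong (_+ (y + D)) (dual-eq r X[ J ] spanned) ⟨
    dual r X[ J ] + r ⊤ + (y + D)         ≡⟨ xy∙z≈xz∙y (dual r X[ J ]) (r ⊤) (y + D) ⟩
    dual r X[ J ] + (y + D) + r ⊤         ∎)
    where
    open ≡-Reasoning
    x = ∣ X[ J ] ∣
    y = ∣ Y[ J ] ∣
    D = wsum d J
    D′ = wsum d (∁ J)
    spanned : r ⊤ ≤ x + r (∁ X[ J ])
    spanned = subst (λ A → r A ≤ x + r (∁ X[ J ])) (p∪∁p≡⊤ X[ J ]) (rank-∪-≤ M X[ J ] (∁ X[ J ]))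
    pull : ∀ a x t D D′ → a + x + (t + (D + D′)) ≡ a + t + (x + D + D′)
    pull = solve-∀
    pull′ : ∀ y c x D D′ → y + c + (x + D + D′) ≡ x + (c + D′) + (y + D)
    pull′ = solve-∀

  lcStar-core : ∀ {J K} → Disjoint J K → lcStar r X[ J ] X[ K ] ≡ lcStar r̂ Y[ J ] Y[ K ]
  lcStar-core {J} {K} dis = sym (∸-shift
    (dual r̂ Y[ J ]) (dual r̂ Y[ K ]) (dual r̂ (Y[ J ] ∪ Y[ K ]))
    (dual r X[ J ]) (dual r X[ K ]) (dual r (X[ J ] ∪ X[ K ]))
    (dual-core J) (dual-core K) dual-∪
    (∣∪∣-disjoint (unionF-separates dis)) sizes)
    where
    dual-∪ : dual r̂ (Y[ J ] ∪ Y[ K ]) + ∣ X[ J ] ∪ X[ K ] ∣ ≡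
             dual r (X[ J ] ∪ X[ K ]) + (∣ Y[ J ∪ K ] ∣ + wsum d (J ∪ K))
    dual-∪ = subst₂ (λ A B → dual r̂ A + ∣ B ∣ ≡ dual r B + (∣ Y[ J ∪ K ] ∣ + wsum d (J ∪ K)))
      (ySet-∪ n s J K) (unionF-∪ X J K) (dual-core (J ∪ K))
    sizes : ∣ Y[ J ∪ K ] ∣ + wsum d (J ∪ K) ≡ (∣ Y[ J ] ∣ + wsum d J) + (∣ Y[ K ] ∣ + wsum d K)
    sizes rewrite ∣ySet∣ {m} n s (J ∪ K) | ∣ySet∣ {m} n s J | ∣ySet∣ {m} n s K
                | wsum-disjoint s dis | wsum-disjoint d dis = interchange (wsum s J) _ _ _

  ∣coreBlock∣ : ∀ i → ∣ coreBlock r X i ∣ ≡ conn r (X i)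
  ∣coreBlock∣ i = trans (∣ySet∣ n s ⁅ i ⁆) (wsum-⁅⁆ s i)

  -- Since `d i` is the corank of `∁ (X i)`, lowering `r (X i)` by it leaves exactly `conn r (X i)`,
  -- the size of the block.
  coreBlock-independent : ∀ i → independent r̂ (coreBlock r X i)
  coreBlock-independent i = trans (+-cancelʳ-≡ (r ⊤) _ _ (begin
    r̂ Y[ ⁅ i ⁆ ] + r ⊤                              ≡⟨ cong (r̂ Y[ ⁅ i ⁆ ] +_) (d-eq i) ⟨
    r̂ Y[ ⁅ i ⁆ ] + (d i + r (∁ (X i)))              ≡⟨ +-assoc (r̂ Y[ ⁅ i ⁆ ]) _ _ ⟨
    r̂ Y[ ⁅ i ⁆ ] + d i + r (∁ (X i))
      ≡⟨ cong (λ k → r̂ Y[ ⁅ i ⁆ ] + k + r (∁ (X i))) (wsum-⁅⁆ d i) ⟨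
    r̂ Y[ ⁅ i ⁆ ] + wsum d ⁅ i ⁆ + r (∁ (X i))
      ≡⟨ cong (_+ r (∁ (X i))) (trans (r̂-eq ⁅ i ⁆) (cong r (unionF-⁅⁆ X i))) ⟩
    r (X i) + r (∁ (X i))                           ≡⟨ conn-eq M (X i) ⟨
    conn r (X i) + r ⊤                              ∎))
    (sym (∣coreBlock∣ i))
    where open ≡-Reasoning

  -- The point is that the complement of the block has full rank in the core. In the original
  -- matroid `∁ (X i)` falls short of full rank by `d i`, and this is precisely the extra correction
  -- borne by `r̂ ⊤`.
  coreBlock-coindependent : ∀ i → coindependent r̂ (coreBlock r X i)
  coreBlock-coindependent i = +-cancelʳ-≡ (r̂ ⊤) _ _
    (trans (dual-eq r̂ Y[ ⁅ i ⁆ ] (r̂-spanned ⁅ i ⁆))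
           (cong (∣ Y[ ⁅ i ⁆ ] ∣ +_) (+-cancelʳ-≡ (d i + D′) _ _ (begin
    c + (d i + D′)                        ≡⟨ x∙yz≈y∙xz c (d i) D′ ⟩
    d i + (c + D′)                        ≡⟨ cong (d i +_) (r̂-∁ ⁅ i ⁆) ⟩
    d i + r (∁ X[ ⁅ i ⁆ ])                ≡⟨ cong (λ A → d i + r (∁ A)) (unionF-⁅⁆ X i) ⟩
    d i + r (∁ (X i))                     ≡⟨ d-eq i ⟩
    r ⊤                                   ≡⟨ r̂-⊤ ⟨
    r̂ ⊤ + wsum d ⊤                        ≡⟨ cong (r̂ ⊤ +_) (wsum-∁ d ⁅ i ⁆) ⟩
    r̂ ⊤ + (wsum d ⁅ i ⁆ + D′)             ≡⟨ cong (λ k → r̂ ⊤ + (k + D′)) (wsum-⁅⁆ d i) ⟩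
    r̂ ⊤ + (d i + D′)                      ∎))))
    where
    open ≡-Reasoning
    c = r̂ (∁ Y[ ⁅ i ⁆ ])
    D′ = wsum d (∁ ⁅ i ⁆)

  coreSize-eq : coreSize r X ≡ sum (tabulate s)
  coreSize-eq = begin
    coreSize r X      ≡⟨ ∣⊤∣≡n _ ⟨
    ∣ ⊤ {coreSize r X} ∣  ≡⟨ cong ∣_∣ (ySet-⊤ n s) ⟨
    ∣ Y[ ⊤ ] ∣        ≡⟨ ∣ySet∣ n s ⊤ ⟩
    wsum s ⊤          ≡⟨ wsum-⊤ s ⟩
    sum (tabulate s)  ∎
    where open ≡-Reasoning

theorem3p18 : {m n : ℕ} (r : Rk m) → IsMatroid r →
    (X : Fin n → Subset m) → IsPartition X →
    (coreSize r X ≡ sum (tabulate (λ i → conn r (X i))))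
    × (∀ i → independent (coreRk r X) (coreBlock r X i)
    × coindependent (coreRk r X) (coreBlock r X i)
    × Clones (coreRk r X) (coreBlock r X i)
    × ∣ coreBlock r X i ∣ ≡ conn r (X i))
    × (∀ (J K : Subset n) → Nonempty J → Nonempty K → Disjoint J K →
    (conn r (unionF X J) ≡ conn (coreRk r X) (unionF (coreBlock r X) J))
    × (lc r (unionF X J) (unionF X K)
    ≡ lc (coreRk r X) (unionF (coreBlock r X) J) (unionF (coreBlock r X) K))
    × (lcStar r (unionF X J) (unionF X K)
    ≡ lcStar (coreRk r X) (unionF (coreBlock r X) J) (unionF (coreBlock r X) K)))
theorem3p18 {m} {n} r M X part =
    coreSize-eq
  , (λ i → coreBlock-independent i , coreBlock-coindependent i , coreBlock-clones M X i , ∣coreBlock∣ i)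
  , λ J K _ _ dis →
      trans (conn-core J) (cong (conn r̂) (sym (unionF-coreBlock J)))
    , trans (lc-core dis) (sym (cong₂ (lc r̂) (unionF-coreBlock J) (unionF-coreBlock K)))
    , trans (lcStar-core dis) (sym (cong₂ (lcStar r̂) (unionF-coreBlock J) (unionF-coreBlock K)))
  where open Core M part
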